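{- Let $Z:\mathfrak{H}^0\to\mathbb{R}$ be a $\mathbb{Q}$-linear map such that $Z\bigl(\mu(\mathbf{k},\mathbf{l})\bigr)=Z\bigl(\mathbf{k}\circledast\mathbf{l}^\star\bigr)$ for all non-empty indices $\mathbf{k},\mathbf{l}$. Then $Z(\mathbf{k}\sqcup\!\sqcup\mathbf{l})=Z(\mathbf{k})Z(\mathbf{l})$ for all admissible indices $\mathbf{k},\mathbf{l}$ if and only if $Z(\mathbf{k}*\mathbf{l})=Z(\mathbf{k})Z(\mathbf{l})$ for all admissible indices $\mathbf{k},\mathbf{l}$.
   Context: Let $\mathfrak{H}=\mathbb{Q}\langle e_0,e_1\rangle$, $\mathfrak{H}^1=\mathbb{Q}+e_1\mathfrak{H}$, $\mathfrak{H}^0=\mathbb{Q}+e_1\mathfrak{H}e_0$, $e_k=e_1e_0^{k-1}$. Indices (finite possibly empty sequences $(k_1,\dots,k_r)$ of positive integers; admissible if empty or $k_r\ge2$) are identified with words $e_{k_1}\cdots e_{k_r}$ (empty $\leftrightarrow1$); maps are extended linearly. Shuffle $\sqcup\!\sqcup$: bilinear, $1\sqcup\!\sqcup w=w\sqcup\!\sqcup1=w$, $av\sqcup\!\sqcup bw=a(v\sqcup\!\sqcup bw)+b(av\sqcup\!\sqcup w)$ ($a,b\in\{e_0,e_1\}$). Harmonic $*$ on $\mathfrak{H}^1$: $1*w=w*1=w$, $e_kv*e_lw=e_k(v*e_lw)+e_l(e_kv*w)+e_{k+l}(v*w)$. $\circledast:e_1\mathfrak{H}\times e_1\mathfrak{H}\to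 e_1\mathfrak{H}e_0$ is bilinear with $ve_k\circledast we_l=(v*w)e_{k+l}$ ($v,w\in\mathfrak{H}^1$). For non-empty $\mathbf{l}=(l_1,\dots,l_s)$, $\mathbf{l}^\star$ is the sum of the $2^{s-1}$ indices $(l_1\bigcirc\cdots\bigcirc l_s)$, each $\bigcirc$ a comma or plus. A 2-poset is a finite poset with labels $\delta:X\to\{0,1\}$; $W(X)$ is the sum over all linear extensions $x_1,\dots,x_n$ of $e_{\delta(x_1)}\cdots e_{\delta(x_n)}$. For non-empty $\mathbf{k}=(k_1,\dots,k_r)$ of weight $K$ and non-empty $\mathbf{l}=(l_1,\dots,l_s)$, $\mu(\mathbf{k},\mathbf{l})=W(Q)$ where $Q$ has elements $a_1,\dots,a_K$ and $b_{j,i}$ ($1\le j\le s$, $1\le i\le l_j$), order generated by $a_1<\cdots<a_K<b_{s,1}$, $b_{j,1}<\cdots<b_{j,l_j}$, $b_{j-1,1}<b_{j,l_j}$ ($2\le j\le s$), and labels $\delta(a_t)=1$ iff $t\in\{1,k_1+1,\dots,k_1+\dots+k_{r-1}+1\}$ (else 0), $\delta(b_{s,1})=0$, $\delta(b_{j,1})=1$ for $j<s$, $\delta(b_{j,i})=0$ for $i\ge2$. -}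

module Defs where

open import Level using (Level; _⊔_)
open import Data.Bool using (Bool; true; false; if_then_else_; _∧_)
open import Data.Nat using (ℕ; zero; suc; _+_; _∸_; _≤_; _<ᵇ_; _≡ᵇ_)
open import Data.List using (List; []; _∷_; _++_; map; concatMap; filter; foldr; upTo; length)
open import Data.Bool.ListAction using (all; any)
open import Data.List.Relation.Unary.All using (All)
open import Data.Product using (_×_; _,_; proj₁; proj₂)
open import Data.Unit using (⊤)
open import Relation.Nullary.Decidable using (Dec)
open import Relation.Binary.PropositionalEquality using (_≡_)
open import Algebra.Bundles using (CommutativeRing)
open import Algebra.Morphism.Structures using (module RingMorphisms)
open import Data.Rational using (ℚ)
import Data.Rational.Base as ℚB

-- Words in 𝔥 = ℚ⟨e₀,e₁⟩ and formal sums with nonnegative integer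
-- coefficients (a list of words = the sum of its entries, with multiplicity).

data Letter : Set where
  e0 e1 : Letter

Word : Set
Word = List Letter

-- formal sum of words (every element of 𝔥 occurring in the statement has
-- nonnegative integer coefficients)
FSum : Set
FSum = List Word

_⧢_ : Word → Word → FSum
[] ⧢ w = w ∷ []
(a ∷ v) ⧢ [] = (a ∷ v) ∷ []
(a ∷ v) ⧢ (b ∷ w) = map (a ∷_) (v ⧢ (b ∷ w)) ++ map (b ∷_) ((a ∷ v) ⧢ w)

-- Indices: lists of natural numbers (the entries are required to be
-- positive wherever indices are quantified, see `IsIndex`).

Index : Set
Index = List ℕ

IsIndex : Index → Set
IsIndex ks = All (λ k → 1 ≤ k) ks

NonEmpty : Index → Set
NonEmpty [] = Data.Empty.⊥ where import Data.Empty
NonEmpty (_ ∷ _) = ⊤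

LastGe2 : Index → Set
LastGe2 [] = ⊤
LastGe2 (k ∷ []) = 2 ≤ k
LastGe2 (_ ∷ k ∷ ks) = LastGe2 (k ∷ ks)

Admissible : Index → Set
Admissible ks = IsIndex ks × LastGe2 ks

replicate0 : ℕ → Word
replicate0 zero = []
replicate0 (suc n) = e0 ∷ replicate0 n

eWord : ℕ → Word
eWord k = e1 ∷ replicate0 (k ∸ 1)

toWord : Index → Word
toWord [] = []
toWord (k ∷ ks) = eWord k ++ toWord ks

_✶_ : Index → Index → List Index
[] ✶ l = l ∷ []
(k ∷ ks) ✶ [] = (k ∷ ks) ∷ []
(k ∷ ks) ✶ (l ∷ ls) =
  map (k ∷_) (ks ✶ (l ∷ ls)) ++ map (l ∷_) ((k ∷ ks) ✶ ls) ++ map ((k + l) ∷_) (ks ✶ ls)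

unsnoc : Index → List (Index × ℕ)
unsnoc [] = []
unsnoc (k ∷ []) = ([] , k) ∷ []
unsnoc (k ∷ k' ∷ ks) = map (λ p → (k ∷ proj₁ p , proj₂ p)) (unsnoc (k' ∷ ks))

-- v e_k ⊛ w e_l = (v * w) e_{k+l}   (only used for non-empty arguments)
_⊛_ : Index → Index → List Index
ks ⊛ ls = concatMap (λ p → concatMap (λ q →
            map (λ u → u ++ ((proj₂ p + proj₂ q) ∷ [])) (proj₁ p ✶ proj₁ q))
            (unsnoc ls)) (unsnoc ks)

starFrom : ℕ → Index → List Index
starFrom a [] = (a ∷ []) ∷ []
starFrom a (l ∷ ls) = map (a ∷_) (starFrom l ls) ++ starFrom (a + l) ls

star : Index → List Index
star [] = []
star (l ∷ ls) = starFrom l ls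

circStar : Index → Index → List Index
circStar ks ls = concatMap (λ l' → ks ⊛ l') (star ls)

-- 2-posets given by a list of (distinct) elements, labels, and a list of
-- generating relations x < y.  A linear extension of the generated order is
-- exactly an ordering of all elements respecting every generating relation.

Elem : Set
Elem = ℕ × ℕ

_≟ᴱ_ : Elem → Elem → Bool
(a , b) ≟ᴱ (c , d) = (a ≡ᵇ c) ∧ (b ≡ᵇ d)

pos : Elem → List Elem → ℕ
pos x [] = zero
pos x (y ∷ ys) = if x ≟ᴱ y then zero else suc (pos x ys)

insertions : {A : Set} → A → List A → List (List A)
insertions x [] = (x ∷ []) ∷ []
insertions x (y ∷ ys) = (x ∷ y ∷ ys) ∷ map (y ∷_) (insertions x ys)

permutations : {A : Set} → List A → List (List A)
permutations [] = [] ∷ []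
permutations (x ∷ xs) = concatMap (insertions x) (permutations xs)

filterᵇ : {A : Set} → (A → Bool) → List A → List A
filterᵇ p [] = []
filterᵇ p (x ∷ xs) = if p x then x ∷ filterᵇ p xs else filterᵇ p xs

respects : List (Elem × Elem) → List Elem → Bool
respects gens σ = all (λ g → pos (proj₁ g) σ <ᵇ pos (proj₂ g) σ) gens

linearExtensions : List Elem → List (Elem × Elem) → List (List Elem)
linearExtensions elems gens = filterᵇ (respects gens) (permutations elems)

W : List Elem → (Elem → Letter) → List (Elem × Elem) → FSum
W elems δ gens = map (map δ) (linearExtensions elems gens)

-- The 2-poset Q(𝐤,𝐥):  a_t ↦ (0 , t)  (1 ≤ t ≤ K),  b_{j,i} ↦ (j , i).

chain : List Elem → List (Elem × Elem)
chain [] = []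
chain (x ∷ []) = []
chain (x ∷ y ∷ xs) = (x , y) ∷ chain (y ∷ xs)

oneTo : ℕ → List ℕ
oneTo n = map suc (upTo n)

weight : Index → ℕ
weight = foldr _+_ 0

headPositions : Index → ℕ → List ℕ
headPositions [] acc = []
headPositions (k ∷ ks) acc = suc acc ∷ headPositions ks (acc + k)

enumFrom : ℕ → Index → List (ℕ × ℕ)
enumFrom j [] = []
enumFrom j (l ∷ ls) = (j , l) ∷ enumFrom (suc j) ls

QElems : Index → Index → List Elem
QElems ks ls =
  map (λ t → (0 , t)) (oneTo (weight ks)) ++
  concatMap (λ p → map (λ i → (proj₁ p , i)) (oneTo (proj₂ p))) (enumFrom 1 ls)

QGens : Index → Index → List (Elem × Elem)
QGens ks ls =
  chain (map (λ t → (0 , t)) (oneTo (weight ks))) ++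
  ((0 , weight ks) , (length ls , 1)) ∷
  concatMap (λ p → chain (map (λ i → (proj₁ p , i)) (oneTo (proj₂ p)))) (enumFrom 1 ls) ++
  concatMap (λ p → if proj₁ p ≡ᵇ 1 then [] else ((proj₁ p ∸ 1 , 1) , (proj₁ p , proj₂ p)) ∷ [])
            (enumFrom 1 ls)

QLabel : Index → Index → Elem → Letter
QLabel ks ls (zero , t) = if any (_≡ᵇ t) (headPositions ks 0) then e1 else e0
QLabel ks ls (suc j , 1) = if suc j ≡ᵇ length ls then e0 else e1
QLabel ks ls (suc j , _) = e0

μ : Index → Index → FSum
μ ks ls = W (QElems ks ls) (QLabel ks ls) (QGens ks ls)

-- Target: a commutative ℚ-algebra (stand-in for ℝ), i.e. a commutative ring
-- with a ring homomorphism from ℚ.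

record QAlgebra (c ℓ : Level) : Set (Level.suc (c ⊔ ℓ)) where
  field
    commRing : CommutativeRing c ℓ
  open CommutativeRing commRing public
  field
    fromℚ : ℚ → Carrier
    fromℚ-hom : RingMorphisms.IsRingHomomorphism ℚB.+-*-rawRing rawRing fromℚ

-- ℚ-linear extension of Z (given on the basis of words) to formal sums
module _ {c ℓ : Level} (R : QAlgebra c ℓ) where
  open QAlgebra R using (Carrier) renaming (_+_ to _+ᴿ_; 0# to 0ᴿ)

  Zsum : (Word → Carrier) → FSum → Carrier
  Zsum Z ws = foldr (λ w acc → Z w +ᴿ acc) 0ᴿ ws

  ZsumI : (Word → Carrier) → List Index → Carrier
  ZsumI Z ks = Zsum Z (map toWord ks)

{-# OPTIONS --safe #-}
module Submission where

-- For non-empty indices 𝐤 = (k₁,…,k_r) and 𝐥 = (l₁,…,l_s) both sides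
-- of the integral-series identity satisfy the same recursion.  In the 2-poset Q,
-- dropping a relation b_{j,1} < b_{j+1,l_{j+1}} gives a disjoint union, hence a
-- shuffle product, and reversing it glues two columns into one chain.  For
-- 𝐤 ⊛ 𝐥^⋆, read as a sum over m₁ < ⋯ < m_r = n_s ≥ ⋯ ≥ n₁, dropping n_j ≤ n_{j+1}
-- gives a harmonic product and reversing it gives n_{j+1} < n_j.  Once all links
-- are reversed, both sides are the index (k₁,…,k_r + l_s, l_{s-1},…,l₁).  Thus,
-- with 𝐝 = (l_j,…,l₁) and 𝐥′ = (l_{j+1},…,l_s),
--   μ(𝐤,𝐥′) ⧢ 𝐝   and   (𝐤 ⊛ 𝐥′^⋆) * 𝐝
-- are each the sum of the terms for the j-th link kept and for the j-th link
-- reversed.  By induction on the depth of the admissible index 𝐝, Z agrees on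
-- 𝐮 ⧢ 𝐝 and 𝐮 * 𝐝 for all admissible 𝐮: the case 𝐥′ = (1) yields this for 𝐝 from
-- the agreement of the terms attached to 𝐝, and either multiplicativity
-- hypothesis then propagates the agreement of these terms to a longer 𝐝.
open import Defs
open import Level using (Level)
open import Algebra.Bundles using (CommutativeRing)
import Algebra.Solver.CommutativeMonoid
open import Data.Bool using (Bool; true; false; if_then_else_; _∧_; not; T)
open import Data.Bool.ListAction using (any)
open import Data.Bool.Properties using (∧-assoc; ∧-comm; ∧-commutativeMonoid)
open import Data.Empty using (⊥-elim)
open import Data.List using (List; []; _∷_; _++_; _∷ʳ_; map; concatMap; foldr; length; applyUpTo)
open import Data.List.Properties using (++-identityʳ; ++-assoc; map-++; map-∘; ∷-injective)
open import Data.List.Membership.Propositional using (_∈_; _∉_)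
open import Data.List.Membership.Propositional.Properties using (∈-++⁺ˡ; ∈-++⁺ʳ; ∈-++⁻)
open import Data.List.Relation.Binary.Disjoint.Propositional using (Disjoint)
open import Data.List.Relation.Binary.Permutation.Propositional as ↭ using (_↭_; prep; swap; ↭-refl; ↭-sym; ↭-trans; ↭⇒↭ₛ; ↭-reflexive)
open import Data.List.Relation.Binary.Permutation.Propositional.Properties using (∈-resp-↭; ++⁺ˡ; ++⁺ʳ; ++-comm)
import Data.List.Relation.Binary.Permutation.Setoid.Properties as ↭ₛ
open import Data.List.Relation.Ternary.Interleaving.Propositional as I using (Interleaving; []; consˡ; consʳ)
open import Data.List.Relation.Unary.All as All using (All; []; _∷_)
import Data.List.Relation.Unary.All.Properties as Allₚ
open import Data.List.Relation.Unary.AllPairs using ([]; _∷_)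
open import Data.List.Relation.Unary.Any using (here; there)
open import Data.List.Relation.Unary.Unique.Propositional using (Unique)
import Data.List.Relation.Unary.Unique.Propositional.Properties as Uniqueₚ
open import Data.Nat using (ℕ; zero; suc; _+_; _∸_; _≡ᵇ_; _<ᵇ_; _≤_; _<_; z≤n; s≤s)
import Data.Nat.Properties as ℕₚ
open import Data.Product using (_×_; _,_; proj₁; proj₂; ∃; ∃₂; map₂)
open import Data.Sum as Sum using (_⊎_; inj₁; inj₂)
open import Data.Unit using (tt)
open import Function using (_∘_)
open import Function.Bundles using (_⇔_; mk⇔)
open import Relation.Binary.PropositionalEquality as ≡ using (_≡_; _≢_; refl)

snocView : {A : Set} (x : A) (xs : List A) → ∃₂ λ ys y → ys ∷ʳ y ≡ x ∷ xs
snocView x [] = [] , x , refl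
snocView x (y ∷ ys) with snocView y ys
... | zs , z , e = x ∷ zs , z , ≡.cong (x ∷_) e

-- Finite sums in a commutative ring

module RingSums {c ℓ} (R : CommutativeRing c ℓ) where
  open CommutativeRing R hiding (refl; sym; trans) renaming (_+_ to _+ᴿ_; _*_ to _*ᴿ_; _-_ to _-ᴿ_; -_ to -ᴿ_) public
  module ≈ = CommutativeRing R using (refl; sym; trans; reflexive)
  open import Relation.Binary.Reasoning.Setoid setoid public
  open Algebra.Solver.CommutativeMonoid +-commutativeMonoid using (solve; _⊜_) renaming (_⊕_ to _⊞_) public

  -- Opaque, so that the arguments of ∑ can be inferred by unification.
  opaque
    ∑ : {A : Set} → (A → Carrier) → List A → Carrier
    ∑ f = foldr (λ x acc → f x +ᴿ acc) 0#

    ∑-foldr : {A : Set} (f : A → Carrier) → ∀ xs → foldr (λ x acc → f x +ᴿ acc) 0# xs ≡ ∑ f xs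
    ∑-foldr f xs = refl

    ∑-[] : {A : Set} (f : A → Carrier) → ∑ f [] ≈ 0#
    ∑-[] f = ≈.refl

    ∑-∷ : {A : Set} (f : A → Carrier) → ∀ x xs → ∑ f (x ∷ xs) ≈ f x +ᴿ ∑ f xs
    ∑-∷ f x xs = ≈.refl

    ∑-cong-All : {A : Set} {f g : A → Carrier} {xs : List A} →
      All (λ x → f x ≈ g x) xs → ∑ f xs ≈ ∑ g xs
    ∑-cong-All [] = ≈.refl
    ∑-cong-All (e ∷ es) = +-cong e (∑-cong-All es)

    ∑-cong : {A : Set} {f g : A → Carrier} → (∀ x → f x ≈ g x) → ∀ xs → ∑ f xs ≈ ∑ g xs
    ∑-cong e [] = ≈.refl
    ∑-cong e (x ∷ xs) = +-cong (e x) (∑-cong e xs)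

    ∑-++ : {A : Set} (f : A → Carrier) → ∀ xs ys → ∑ f (xs ++ ys) ≈ ∑ f xs +ᴿ ∑ f ys
    ∑-++ f [] ys = ≈.sym (+-identityˡ _)
    ∑-++ f (x ∷ xs) ys = ≈.trans (+-congˡ (∑-++ f xs ys)) (≈.sym (+-assoc _ _ _))

    ∑-map : {A B : Set} (f : A → Carrier) (h : B → A) → ∀ xs → ∑ f (map h xs) ≡ ∑ (f ∘ h) xs
    ∑-map f h [] = refl
    ∑-map f h (x ∷ xs) = ≡.cong (f (h x) +ᴿ_) (∑-map f h xs)

    ∑-concatMap : {A B : Set} (f : A → Carrier) (h : B → List A) → ∀ xs →
      ∑ f (concatMap h xs) ≈ ∑ (λ x → ∑ f (h x)) xs
    ∑-concatMap f h [] = ≈.refl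
    ∑-concatMap f h (x ∷ xs) =
      ≈.trans (∑-++ f (h x) (concatMap h xs)) (+-congˡ (∑-concatMap f h xs))

    ∑-singleton : {A : Set} (f : A → Carrier) → ∀ x → ∑ f (x ∷ []) ≈ f x
    ∑-singleton f x = +-identityʳ (f x)

    ∑-0 : {A : Set} (xs : List A) → ∑ (λ _ → 0#) xs ≈ 0#
    ∑-0 [] = ≈.refl
    ∑-0 (x ∷ xs) = ≈.trans (+-identityˡ _) (∑-0 xs)

    ∑-+ : {A : Set} (f g : A → Carrier) → ∀ xs → ∑ (λ x → f x +ᴿ g x) xs ≈ ∑ f xs +ᴿ ∑ g xs
    ∑-+ f g [] = ≈.sym (+-identityˡ _)
    ∑-+ f g (x ∷ xs) = ≈.trans (+-congˡ (∑-+ f g xs))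
      (solve 4 (λ a b c d → (a ⊞ b) ⊞ (c ⊞ d) ⊜ (a ⊞ c) ⊞ (b ⊞ d)) ≈.refl _ _ _ _)

    ∑-*ʳ : {A : Set} (f : A → Carrier) (r : Carrier) → ∀ xs → ∑ (λ x → f x *ᴿ r) xs ≈ ∑ f xs *ᴿ r
    ∑-*ʳ f r [] = ≈.sym (zeroˡ r)
    ∑-*ʳ f r (x ∷ xs) = ≈.trans (+-congˡ (∑-*ʳ f r xs)) (≈.sym (distribʳ r _ _))

    ∑-comm : {A B : Set} (f : A → B → Carrier) → ∀ xs ys →
      ∑ (λ x → ∑ (f x) ys) xs ≈ ∑ (λ y → ∑ (λ x → f x y) xs) ys
    ∑-comm f [] ys = ≈.sym (∑-0 ys)
    ∑-comm f (x ∷ xs) ys = ≈.trans (+-congˡ (∑-comm f xs ys)) (≈.sym (∑-+ (f x) _ ys))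

  +≈⇒≈- : ∀ {x y z} → x ≈ y +ᴿ z → y ≈ x -ᴿ z
  +≈⇒≈- {x} {y} {z} e = ≈.sym (begin
    x -ᴿ z ≈⟨ +-congʳ e ⟩
    (y +ᴿ z) -ᴿ z ≈⟨ +-assoc y z (-ᴿ z) ⟩
    y +ᴿ (z -ᴿ z) ≈⟨ +-congˡ (-‿inverseʳ z) ⟩
    y +ᴿ 0# ≈⟨ +-identityʳ y ⟩
    y ∎)

  +-zeros : ∀ {x y z} → y ≈ 0# → z ≈ 0# → x +ᴿ (y +ᴿ z) ≈ x
  +-zeros y≈0 z≈0 =
    ≈.trans (+-congˡ (≈.trans (+-cong y≈0 z≈0) (+-identityˡ 0#))) (+-identityʳ _)

  -ᴿ-cancel : ∀ {x y x′ y′} → x -ᴿ y ≈ x′ -ᴿ y′ → y ≈ y′ → x ≈ x′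
  -ᴿ-cancel {x} {y} {x′} {y′} e y≈y′ = begin
    x ≈⟨ add x y ⟨
    (x -ᴿ y) +ᴿ y ≈⟨ +-cong e y≈y′ ⟩
    (x′ -ᴿ y′) +ᴿ y′ ≈⟨ add x′ y′ ⟩
    x′ ∎
    where
    add : ∀ x y → (x -ᴿ y) +ᴿ y ≈ x
    add x y = ≈.trans (+-assoc x (-ᴿ y) y) (≈.trans (+-congˡ (-‿inverseˡ y)) (+-identityʳ x))

  -- Kept-link term = product minus reversed-link term, so agreement of any two forces agreement of
  -- the third. This form recovers the reversed-link term, `-ᴿ-cancel` the product.
  -ᴿ-cancelˡ : ∀ {x y x′ y′} → x -ᴿ y ≈ x′ -ᴿ y′ → x ≈ x′ → y ≈ y′
  -ᴿ-cancelˡ {x} {y} {x′} {y′} e x≈x′ = begin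
    y ≈⟨ sub x y ⟨
    x -ᴿ (x -ᴿ y) ≈⟨ +-cong x≈x′ (-‿cong e) ⟩
    x′ -ᴿ (x′ -ᴿ y′) ≈⟨ sub x′ y′ ⟩
    y′ ∎
    where
    sub : ∀ x y → x -ᴿ (x -ᴿ y) ≈ y
    sub x y = ≈.sym (+≈⇒≈- (≈.sym (≈.trans (+-comm y _)
      (≈.trans (+-assoc x (-ᴿ y) y) (≈.trans (+-congˡ (-‿inverseˡ y)) (+-identityʳ x))))))

-- Quasi-shuffles

-- Generic in the product of letters, so that one development serves both plain entries under `_+_`
-- and marked letters under `_⊕_`.
Stuffle : {A : Set} → (A → A → A) → List A → List A → List (List A)
Stuffle _∙_ [] v = v ∷ []
Stuffle _∙_ (a ∷ u) [] = (a ∷ u) ∷ []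
Stuffle _∙_ (a ∷ u) (b ∷ v) =
  map (a ∷_) (Stuffle _∙_ u (b ∷ v)) ++
  map (b ∷_) (Stuffle _∙_ (a ∷ u) v) ++
  map ((a ∙ b) ∷_) (Stuffle _∙_ u v)

Stuffle-ℕ : ∀ u v → Stuffle _+_ u v ≡ u ✶ v
Stuffle-ℕ [] v = refl
Stuffle-ℕ (a ∷ u) [] = refl
Stuffle-ℕ (a ∷ u) (b ∷ v)
  rewrite Stuffle-ℕ u (b ∷ v) | Stuffle-ℕ (a ∷ u) v | Stuffle-ℕ u v = refl

Stuffle-[] : {A : Set} (_∙_ : A → A → A) (u : List A) → Stuffle _∙_ u [] ≡ u ∷ []
Stuffle-[] _∙_ [] = refl
Stuffle-[] _∙_ (a ∷ u) = refl

-- (n , m) is the letter n carrying m marks.  The last letters of 𝐤 and of the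
-- terms of 𝐥^⋆ are marked, so that 𝐤 ⊛ 𝐥^⋆ is the part of 𝐤 * 𝐥^⋆ where both
-- marks meet in one letter.

Marked : Set
Marked = ℕ × ℕ

-- Marks add up when letters merge, so two marked letters that have merged carry the count 2, while
-- a count of 1 betrays a mark left alone.
_⊕_ : Marked → Marked → Marked
(a , m) ⊕ (b , n) = a + b , m + n

plain : ℕ → Marked
plain a = a , 0

_✶ᴹ_ : List Marked → List Marked → List (List Marked)
_✶ᴹ_ = Stuffle _⊕_

⊕-assoc : ∀ x y z → (x ⊕ y) ⊕ z ≡ x ⊕ (y ⊕ z)
⊕-assoc (a , m) (b , n) (c , p) = ≡.cong₂ _,_ (ℕₚ.+-assoc a b c) (ℕₚ.+-assoc m n p)

⊕-comm : ∀ x y → x ⊕ y ≡ y ⊕ x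
⊕-comm (a , m) (b , n) = ≡.cong₂ _,_ (ℕₚ.+-comm a b) (ℕₚ.+-comm m n)

markLast : ℕ → Index → List Marked
markLast x [] = (x , 1) ∷ []
markLast x (y ∷ ys) = plain x ∷ markLast y ys

markLast-∷ʳ : ∀ w p x xs → w ∷ʳ p ≡ x ∷ xs → markLast x xs ≡ map plain w ∷ʳ (p , 1)
markLast-∷ʳ [] p x xs refl = refl
markLast-∷ʳ (y ∷ []) p x xs refl = refl
markLast-∷ʳ (y ∷ z ∷ w) p x xs refl = ≡.cong (plain y ∷_) (markLast-∷ʳ (z ∷ w) p _ _ refl)

unsnoc-∷ʳ : ∀ w p → unsnoc (w ∷ʳ p) ≡ (w , p) ∷ []
unsnoc-∷ʳ [] p = refl
unsnoc-∷ʳ (y ∷ []) p = refl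
unsnoc-∷ʳ (y ∷ z ∷ w) p rewrite unsnoc-∷ʳ (z ∷ w) p = refl

-- The series side: evaluating 𝐤 ⊛ 𝐥^⋆

module Harmonic {c ℓ} (R : CommutativeRing c ℓ) where
  open RingSums R

  module _ {A : Set} (_∙_ : A → A → A) where

    ∑-Stuffle-∷ : (F : List A → Carrier) → ∀ a u b v →
      ∑ F (Stuffle _∙_ (a ∷ u) (b ∷ v)) ≈
      ∑ (F ∘ (a ∷_)) (Stuffle _∙_ u (b ∷ v)) +ᴿ
      (∑ (F ∘ (b ∷_)) (Stuffle _∙_ (a ∷ u) v) +ᴿ ∑ (F ∘ ((a ∙ b) ∷_)) (Stuffle _∙_ u v))
    ∑-Stuffle-∷ F a u b v = begin
      ∑ F (map (a ∷_) xs ++ (map (b ∷_) ys ++ map ((a ∙ b) ∷_) zs))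
        ≈⟨ ≈.trans (∑-++ F _ _) (+-congˡ (∑-++ F _ _)) ⟩
      ∑ F (map (a ∷_) xs) +ᴿ (∑ F (map (b ∷_) ys) +ᴿ ∑ F (map ((a ∙ b) ∷_) zs))
        ≡⟨ ≡.cong₂ _+ᴿ_ (∑-map F _ xs) (≡.cong₂ _+ᴿ_ (∑-map F _ ys) (∑-map F _ zs)) ⟩
      ∑ (F ∘ (a ∷_)) xs +ᴿ (∑ (F ∘ (b ∷_)) ys +ᴿ ∑ (F ∘ ((a ∙ b) ∷_)) zs) ∎
      where
      xs = Stuffle _∙_ u (b ∷ v)
      ys = Stuffle _∙_ (a ∷ u) v
      zs = Stuffle _∙_ u v

    ∑-Stuffle-[] : (F : List A → Carrier) → ∀ u → ∑ F (Stuffle _∙_ u []) ≈ F u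
    ∑-Stuffle-[] F u rewrite Stuffle-[] _∙_ u = ∑-singleton F u

    -- Both sides are sorted by the first letter of the resulting word, which is the product of one
    -- of the seven non-empty subsets of the heads a, b, d. Each class is a smaller instance, with F
    -- precomposed by that letter.
    ∑-Stuffle-assoc : (∀ x y z → (x ∙ y) ∙ z ≡ x ∙ (y ∙ z)) → (F : List A → Carrier) → ∀ u v w →
      ∑ (λ x → ∑ F (Stuffle _∙_ x w)) (Stuffle _∙_ u v) ≈
      ∑ (λ y → ∑ F (Stuffle _∙_ u y)) (Stuffle _∙_ v w)
    ∑-Stuffle-assoc assoc F [] v w =
      ≈.trans (∑-singleton _ v) (∑-cong (λ y → ≈.sym (∑-singleton F y)) (Stuffle _∙_ v w))
    ∑-Stuffle-assoc assoc F (a ∷ u) [] w =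
      ≈.trans (∑-singleton _ (a ∷ u)) (≈.sym (∑-singleton _ w))
    ∑-Stuffle-assoc assoc F (a ∷ u) (b ∷ v) [] =
      ≈.trans (∑-cong (∑-Stuffle-[] F) _) (≈.sym (∑-singleton _ (b ∷ v)))
    ∑-Stuffle-assoc assoc F (a ∷ u) (b ∷ v) (d ∷ w) = begin
      ∑ (λ x → ∑ F (x ∗ (d ∷ w))) ((a ∷ u) ∗ (b ∷ v))
        ≈⟨ ∑-Stuffle-∷ _ a u b v ⟩
      L a (u ∗ (b ∷ v)) +ᴿ (L b ((a ∷ u) ∗ v) +ᴿ L (a ∙ b) (u ∗ v))
        ≈⟨ +-cong (expandL a _) (+-cong (expandL b _) (expandL (a ∙ b) _)) ⟩
      _ ≈⟨ solve 9 (λ p₁ q₁ r₁ p₂ q₂ r₂ p₃ q₃ r₃ →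
             (p₁ ⊞ (q₁ ⊞ r₁)) ⊞ ((p₂ ⊞ (q₂ ⊞ r₂)) ⊞ (p₃ ⊞ (q₃ ⊞ r₃))) ⊜
             (p₁ ⊞ (p₂ ⊞ p₃)) ⊞ ((q₁ ⊞ (q₂ ⊞ q₃)) ⊞ (r₁ ⊞ (r₂ ⊞ r₃))))
             ≈.refl _ _ _ _ _ _ _ _ _ ⟩
      (L₁ a (u ∗ (b ∷ v)) +ᴿ (L₁ b ((a ∷ u) ∗ v) +ᴿ L₁ (a ∙ b) (u ∗ v))) +ᴿ
      ((L₂ a (u ∗ (b ∷ v)) +ᴿ (L₂ b ((a ∷ u) ∗ v) +ᴿ L₂ (a ∙ b) (u ∗ v))) +ᴿ
       (L₃ a (u ∗ (b ∷ v)) +ᴿ (L₃ b ((a ∷ u) ∗ v) +ᴿ L₃ (a ∙ b) (u ∗ v))))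
        ≈⟨ +-cong
             (+-cong (ih (F ∘ (a ∷_)) u (b ∷ v) (d ∷ w))
               (+-cong (ih (F ∘ (b ∷_)) (a ∷ u) v (d ∷ w)) (ih (F ∘ ((a ∙ b) ∷_)) u v (d ∷ w))))
             -- The three summands with first letter d reassemble into one full product of a ∷ u and
             -- b ∷ v before the induction applies.
             (+-cong (≈.trans (≈.sym (∑-Stuffle-∷ _ a u b v)) (ih (F ∘ (d ∷_)) (a ∷ u) (b ∷ v) w))
               (+-cong (ih (F ∘ ((a ∙ d) ∷_)) u (b ∷ v) w)
                 (+-cong (ih (F ∘ ((b ∙ d) ∷_)) (a ∷ u) v w)
                   (≈.trans (ih (F ∘ (((a ∙ b) ∙ d) ∷_)) u v w)
                     (≈.reflexive (≡.cong (λ e → ∑ (λ y → ∑ (F ∘ (e ∷_)) (u ∗ y)) (v ∗ w)) (assoc a b d))))))) ⟩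
      (∑ (λ y → ∑ (F ∘ (a ∷_)) (u ∗ y)) ((b ∷ v) ∗ (d ∷ w)) +ᴿ
         (R₂ b (v ∗ (d ∷ w)) +ᴿ R₃ b (v ∗ (d ∷ w)))) +ᴿ
      (R₂ d ((b ∷ v) ∗ w) +ᴿ
        (R₃ d ((b ∷ v) ∗ w) +ᴿ (R₂ (b ∙ d) (v ∗ w) +ᴿ R₃ (b ∙ d) (v ∗ w))))
        -- Symmetrically, the class of a is spread over the three heads of the product of b ∷ v and
        -- d ∷ w.
        ≈⟨ +-congʳ (+-congʳ (∑-Stuffle-∷ _ b v d w)) ⟩
      ((R₁ b (v ∗ (d ∷ w)) +ᴿ (R₁ d ((b ∷ v) ∗ w) +ᴿ R₁ (b ∙ d) (v ∗ w))) +ᴿ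
         (R₂ b (v ∗ (d ∷ w)) +ᴿ R₃ b (v ∗ (d ∷ w)))) +ᴿ
      (R₂ d ((b ∷ v) ∗ w) +ᴿ
        (R₃ d ((b ∷ v) ∗ w) +ᴿ (R₂ (b ∙ d) (v ∗ w) +ᴿ R₃ (b ∙ d) (v ∗ w))))
        ≈⟨ solve 9 (λ p₁ q₁ r₁ p₂ q₂ r₂ p₃ q₃ r₃ →
             ((p₁ ⊞ (p₂ ⊞ p₃)) ⊞ (q₁ ⊞ r₁)) ⊞ (q₂ ⊞ (r₂ ⊞ (q₃ ⊞ r₃))) ⊜
             (p₁ ⊞ (q₁ ⊞ r₁)) ⊞ ((p₂ ⊞ (q₂ ⊞ r₂)) ⊞ (p₃ ⊞ (q₃ ⊞ r₃))))
             ≈.refl _ _ _ _ _ _ _ _ _ ⟩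
      _ ≈⟨ +-cong (expandR b _) (+-cong (expandR d _) (expandR (b ∙ d) _)) ⟨
      K b (v ∗ (d ∷ w)) +ᴿ (K d ((b ∷ v) ∗ w) +ᴿ K (b ∙ d) (v ∗ w))
        ≈⟨ ∑-Stuffle-∷ _ b v d w ⟨
      ∑ (λ y → ∑ F ((a ∷ u) ∗ y)) ((b ∷ v) ∗ (d ∷ w)) ∎
      where
      _∗_ = Stuffle _∙_
      ih = ∑-Stuffle-assoc assoc
      L L₁ L₂ L₃ K R₁ R₂ R₃ : A → List (List A) → Carrier
      L e xs = ∑ (λ x → ∑ F ((e ∷ x) ∗ (d ∷ w))) xs
      L₁ e xs = ∑ (λ x → ∑ (F ∘ (e ∷_)) (x ∗ (d ∷ w))) xs
      L₂ e xs = ∑ (λ x → ∑ (F ∘ (d ∷_)) ((e ∷ x) ∗ w)) xs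
      L₃ e xs = ∑ (λ x → ∑ (F ∘ ((e ∙ d) ∷_)) (x ∗ w)) xs
      K e xs = ∑ (λ y → ∑ F ((a ∷ u) ∗ (e ∷ y))) xs
      R₁ e xs = ∑ (λ y → ∑ (F ∘ (a ∷_)) (u ∗ (e ∷ y))) xs
      R₂ e xs = ∑ (λ y → ∑ (F ∘ (e ∷_)) ((a ∷ u) ∗ y)) xs
      R₃ e xs = ∑ (λ y → ∑ (F ∘ ((a ∙ e) ∷_)) (u ∗ y)) xs
      expandL : ∀ e xs → L e xs ≈ L₁ e xs +ᴿ (L₂ e xs +ᴿ L₃ e xs)
      expandL e xs = ≈.trans (∑-cong (λ x → ∑-Stuffle-∷ F e x d w) xs)
        (≈.trans (∑-+ _ _ xs) (+-congˡ (∑-+ _ _ xs)))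
      expandR : ∀ e xs → K e xs ≈ R₁ e xs +ᴿ (R₂ e xs +ᴿ R₃ e xs)
      expandR e xs = ≈.trans (∑-cong (λ y → ∑-Stuffle-∷ F a u e y) xs)
        (≈.trans (∑-+ _ _ xs) (+-congˡ (∑-+ _ _ xs)))

  -- Extends F by 0 to the words in which the two marks have not met.
  paired : (Index → Carrier) → List Marked → Carrier
  paired F [] = F []
  paired F ((a , m) ∷ u) = if m ≡ᵇ 1 then 0# else paired (F ∘ (a ∷_)) u

  paired-cong : {F G : Index → Carrier} → (∀ u → F u ≈ G u) → ∀ y → paired F y ≈ paired G y
  paired-cong e [] = e []
  paired-cong e ((a , zero) ∷ y) = paired-cong (e ∘ (a ∷_)) y
  paired-cong e ((a , 1) ∷ y) = ≈.refl
  paired-cong e ((a , suc (suc m)) ∷ y) = paired-cong (e ∘ (a ∷_)) y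

  paired-+ : (F G : Index → Carrier) → ∀ y →
    paired (λ u → F u +ᴿ G u) y ≈ paired F y +ᴿ paired G y
  paired-+ F G [] = ≈.refl
  paired-+ F G ((a , zero) ∷ y) = paired-+ (F ∘ (a ∷_)) (G ∘ (a ∷_)) y
  paired-+ F G ((a , 1) ∷ y) = ≈.sym (+-identityˡ 0#)
  paired-+ F G ((a , suc (suc m)) ∷ y) = paired-+ (F ∘ (a ∷_)) (G ∘ (a ∷_)) y

  paired-plain : (F : Index → Carrier) → ∀ u → paired F (map plain u) ≡ F u
  paired-plain F [] = refl
  paired-plain F (a ∷ u) = paired-plain (F ∘ (a ∷_)) u

  -- Merging with a plain letter leaves the number of marks unchanged, so multiplying by an unmarked
  -- word commutes with discarding the unpaired words.
  paired-✶ : (F : Index → Carrier) → ∀ y ds →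
    ∑ (paired F) (y ✶ᴹ map plain ds) ≈ paired (λ u → ∑ F (Stuffle _+_ u ds)) y
  paired-✶ F [] ds = begin
    ∑ (paired F) (map plain ds ∷ []) ≈⟨ ∑-singleton _ _ ⟩
    paired F (map plain ds) ≡⟨ paired-plain F ds ⟩
    F ds ≈⟨ ∑-singleton F ds ⟨
    ∑ F (ds ∷ []) ∎
  paired-✶ F (x ∷ y) [] =
    ≈.trans (∑-singleton _ (x ∷ y)) (paired-cong (λ u → ≈.sym (∑-Stuffle-[] _+_ F u)) (x ∷ y))
  paired-✶ F ((a , m) ∷ y) (d ∷ ds) =
    ≈.trans (∑-Stuffle-∷ _⊕_ (paired F) (a , m) y (plain d) (map plain ds))
      (≈.trans (+-congˡ (+-congʳ (paired-✶ (F ∘ (d ∷_)) ((a , m) ∷ y) ds))) (cases m))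
    where
    combine : ∀ {p r} → p ≈ paired (λ u → ∑ (F ∘ (a ∷_)) (Stuffle _+_ u (d ∷ ds))) y →
      r ≈ paired (λ u → ∑ (F ∘ ((a + d) ∷_)) (Stuffle _+_ u ds)) y →
      p +ᴿ (paired (λ u → ∑ (F ∘ (d ∷_)) (Stuffle _+_ (a ∷ u) ds)) y +ᴿ r) ≈
      paired (λ u → ∑ F (Stuffle _+_ (a ∷ u) (d ∷ ds))) y
    combine ep er = begin
      _ ≈⟨ +-cong ep (+-congˡ er) ⟩
      _ ≈⟨ +-congˡ (paired-+ _ _ y) ⟨
      _ ≈⟨ paired-+ _ _ y ⟨
      _ ≈⟨ paired-cong (λ u → ∑-Stuffle-∷ _+_ F a u d ds) y ⟨
      paired (λ u → ∑ F (Stuffle _+_ (a ∷ u) (d ∷ ds))) y ∎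
    cases : ∀ m →
      ∑ (paired F ∘ ((a , m) ∷_)) (y ✶ᴹ map plain (d ∷ ds)) +ᴿ
      (paired (λ u → ∑ (F ∘ (d ∷_)) (Stuffle _+_ u ds)) ((a , m) ∷ y) +ᴿ
       ∑ (paired F ∘ (((a , m) ⊕ plain d) ∷_)) (y ✶ᴹ map plain ds)) ≈
      paired (λ u → ∑ F (Stuffle _+_ u (d ∷ ds))) ((a , m) ∷ y)
    cases zero =
      combine (paired-✶ (F ∘ (a ∷_)) y (d ∷ ds)) (paired-✶ (F ∘ ((a + d) ∷_)) y ds)
    -- The single mark of the head survives in all three kinds of terms, so everything vanishes on
    -- both sides.
    cases 1 = ≈.trans (+-zeros ≈.refl (∑-0 _)) (∑-0 _)
    cases (suc (suc m)) =
      combine (paired-✶ (F ∘ (a ∷_)) y (d ∷ ds)) (paired-✶ (F ∘ ((a + d) ∷_)) y ds)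

  -- The mark is last in the left factor and first in the right one. They can meet only after all of
  -- v and before all of dt, which leaves exactly one term.
  paired-marks : (F : Index → Carrier) → ∀ v k d dt →
    ∑ (paired F) ((map plain v ∷ʳ (k , 1)) ✶ᴹ ((d , 1) ∷ map plain dt)) ≈ F (v ++ (k + d) ∷ dt)
  paired-marks F [] k d dt = begin
    _ ≈⟨ ∑-Stuffle-∷ _⊕_ (paired F) (k , 1) [] (d , 1) (map plain dt) ⟩
    _ ≈⟨ +-cong (∑-0 _) (+-congʳ (∑-0 _)) ⟩
    0# +ᴿ (0# +ᴿ ∑ (paired (F ∘ ((k + d) ∷_))) (map plain dt ∷ []))
      ≈⟨ ≈.trans (+-identityˡ _) (+-identityˡ _) ⟩
    _ ≈⟨ ∑-singleton _ _ ⟩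
    _ ≡⟨ paired-plain (F ∘ ((k + d) ∷_)) dt ⟩
    F ((k + d) ∷ dt) ∎
  paired-marks F (a ∷ v) k d dt = begin
    _ ≈⟨ ∑-Stuffle-∷ _⊕_ (paired F) (plain a) (map plain v ∷ʳ (k , 1)) (d , 1) (map plain dt) ⟩
    _ ≈⟨ +-zeros (∑-0 _) (∑-0 _) ⟩
    _ ≈⟨ paired-marks (F ∘ (a ∷_)) v k d dt ⟩
    F (a ∷ v ++ (k + d) ∷ dt) ∎

  -- Both marks are last, so they can meet only at the very end, preceded by an arbitrary term of
  -- the product of v and w. This is the defining formula of `_⊛_`.
  paired-last-marks : (F : Index → Carrier) → ∀ v k w p →
    ∑ (paired F) ((map plain v ∷ʳ (k , 1)) ✶ᴹ (map plain w ∷ʳ (p , 1))) ≈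
    ∑ (λ x → F (x ∷ʳ (k + p))) (Stuffle _+_ v w)
  paired-last-marks F v k [] p = ≈.trans (paired-marks F v k p []) (≈.sym (∑-Stuffle-[] _+_ _ v))
  paired-last-marks F [] k (b ∷ w) p = begin
    _ ≈⟨ ∑-Stuffle-∷ _⊕_ (paired F) (k , 1) [] (plain b) (map plain w ∷ʳ (p , 1)) ⟩
    _ ≈⟨ +-cong (∑-0 _) (+-congˡ (∑-0 _)) ⟩
    _ ≈⟨ ≈.trans (+-identityˡ _) (+-identityʳ _) ⟩
    _ ≈⟨ paired-last-marks (F ∘ (b ∷_)) [] k w p ⟩
    _ ≈⟨ ≈.trans (∑-singleton _ w) (≈.sym (∑-singleton (λ x → F (x ∷ʳ (k + p))) (b ∷ w))) ⟩
    ∑ (λ x → F (x ∷ʳ (k + p))) ((b ∷ w) ∷ []) ∎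
  paired-last-marks F (a ∷ v) k (b ∷ w) p = begin
    _ ≈⟨ ∑-Stuffle-∷ _⊕_ (paired F) (plain a) (map plain v ∷ʳ (k , 1)) (plain b) (map plain w ∷ʳ (p , 1)) ⟩
    _ ≈⟨ +-cong (paired-last-marks (F ∘ (a ∷_)) v k (b ∷ w) p)
           (+-cong (paired-last-marks (F ∘ (b ∷_)) (a ∷ v) k w p)
             (paired-last-marks (F ∘ ((a + b) ∷_)) v k w p)) ⟩
    _ ≈⟨ ∑-Stuffle-∷ _+_ _ a v b w ⟨
    ∑ (λ x → F (x ∷ʳ (k + p))) (Stuffle _+_ (a ∷ v) (b ∷ w)) ∎

  -- Sum over the terms of (l , ls)^⋆, the last entry being marked.
  starSum : (Marked → List Marked → Carrier) → ℕ → Index → Carrier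
  starSum F l [] = F (l , 1) []
  starSum F l (c ∷ cs) =
    starSum (λ x xs → F (plain l) (x ∷ xs)) c cs +ᴿ starSum (λ x xs → F (plain l ⊕ x) xs) c cs

  starSum-cong : {F G : Marked → List Marked → Carrier} → (∀ x xs → F x xs ≈ G x xs) →
    ∀ l ls → starSum F l ls ≈ starSum G l ls
  starSum-cong e l [] = e _ _
  starSum-cong e l (c ∷ cs) =
    +-cong (starSum-cong (λ x xs → e _ _) c cs) (starSum-cong (λ x xs → e _ _) c cs)

  starSum-+ : (F G : Marked → List Marked → Carrier) → ∀ l ls →
    starSum (λ x xs → F x xs +ᴿ G x xs) l ls ≈ starSum F l ls +ᴿ starSum G l ls
  starSum-+ F G l [] = ≈.refl
  starSum-+ F G l (c ∷ cs) = ≈.trans (+-cong (starSum-+ _ _ c cs) (starSum-+ _ _ c cs))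
    (solve 4 (λ a b c d → (a ⊞ b) ⊞ (c ⊞ d) ⊜ (a ⊞ c) ⊞ (b ⊞ d)) ≈.refl _ _ _ _)

  -- Reconciles `starFrom`, which accumulates merged entries on the left, with `starSum`, which
  -- merges l into the first entry of a completed term.
  starSum-merge : (F : Marked → List Marked → Carrier) → ∀ a l ls →
    starSum F (a + l) ls ≈ starSum (λ x xs → F (plain a ⊕ x) xs) l ls
  starSum-merge F a l [] = ≈.refl
  starSum-merge F a l (c ∷ cs) =
    +-congˡ (starSum-cong (λ x xs → ≈.reflexive (≡.cong (λ y → F y xs) (⊕-assoc (plain a) (plain l) x))) c cs)

  ∑-starFrom : (F : Index → Carrier) (G : List Marked → Carrier) →
    (∀ x xs → F (x ∷ xs) ≈ G (markLast x xs)) → ∀ l ls →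
    ∑ F (starFrom l ls) ≈ starSum (λ x xs → G (x ∷ xs)) l ls
  ∑-starFrom F G e l [] = ≈.trans (∑-singleton F _) (e l [])
  ∑-starFrom F G e l (c ∷ cs) = begin
    ∑ F (map (l ∷_) (starFrom c cs) ++ starFrom (l + c) cs) ≈⟨ ∑-++ F _ _ ⟩
    ∑ F (map (l ∷_) (starFrom c cs)) +ᴿ ∑ F (starFrom (l + c) cs)
      ≈⟨ +-congʳ (≈.reflexive (∑-map F (l ∷_) (starFrom c cs))) ⟩
    ∑ (F ∘ (l ∷_)) (starFrom c cs) +ᴿ ∑ F (starFrom (l + c) cs)
      ≈⟨ +-cong (∑-starFrom _ (G ∘ (plain l ∷_)) (λ x xs → e l (x ∷ xs)) c cs)
           (≈.trans (∑-starFrom F G e (l + c) cs) (starSum-merge _ l c cs)) ⟩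
    starSum (λ x xs → G (x ∷ xs)) l (c ∷ cs) ∎

  -- Sum over n₁ < … < nᵢ and n₁ ≤ m₁ ≤ … ≤ mⱼ, for the exponents d ∷ dt of the
  -- first chain and d ∷ ls of the second one; the last entry of d ∷ ls is marked.
  hookSum : (List Marked → Carrier) → ℕ → Index → Index → Carrier
  hookSum F d dt [] = F ((d , 1) ∷ map plain dt)
  hookSum F d dt (c ∷ cs) =
    starSum (λ x xs → ∑ (F ∘ (plain d ∷_)) ((x ∷ xs) ✶ᴹ map plain dt) +ᴿ
                      ∑ (F ∘ ((plain d ⊕ x) ∷_)) (xs ✶ᴹ map plain dt)) c cs

  -- A star term of c, cs starts with c alone or with c merged into the entry that follows; these
  -- are the two summands in `hookSum`.
  starSum-hookSum : (F : List Marked → Carrier) → ∀ c ds cs →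
    starSum (λ x xs → ∑ (F ∘ (x ∷_)) (xs ✶ᴹ map plain ds)) c cs ≈ hookSum F c ds cs
  starSum-hookSum F c ds [] = ∑-singleton _ _
  starSum-hookSum F c ds (c′ ∷ cs) = ≈.sym (starSum-+ _ _ c′ cs)

  starSum-hookSum-[] : (F : List Marked → Carrier) → ∀ c cs →
    starSum (λ x xs → F (x ∷ xs)) c cs ≈ hookSum F c [] cs
  starSum-hookSum-[] F c cs =
    ≈.trans (starSum-cong (λ x xs → ≈.sym (∑-Stuffle-[] _⊕_ (F ∘ (x ∷_)) xs)) c cs) (starSum-hookSum F c [] cs)

  -- Compare the smallest variable of the chain c ∷ cs with that of the chain d ∷ dt.
  hookSum-split : (F : List Marked → Carrier) → ∀ d dt c cs →
    starSum (λ x xs → ∑ F ((x ∷ xs) ✶ᴹ map plain (d ∷ dt))) c cs ≈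
    hookSum F d dt (c ∷ cs) +ᴿ hookSum F c (d ∷ dt) cs
  hookSum-split F d dt c cs = begin
    starSum (λ x xs → ∑ F ((x ∷ xs) ✶ᴹ map plain (d ∷ dt))) c cs
      ≈⟨ starSum-cong (λ x xs → ∑-Stuffle-∷ _⊕_ F x xs (plain d) (map plain dt)) c cs ⟩
    _ ≈⟨ starSum-+ _ _ c cs ⟩
    _ ≈⟨ +-cong (starSum-hookSum F c (d ∷ dt) cs)
           (starSum-cong (λ x xs → +-congˡ (≈.reflexive
             (≡.cong (λ y → ∑ (F ∘ (y ∷_)) (xs ✶ᴹ map plain dt)) (⊕-comm x (plain d))))) c cs) ⟩
    hookSum F c (d ∷ dt) cs +ᴿ hookSum F d dt (c ∷ cs) ≈⟨ +-comm _ _ ⟩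
    hookSum F d dt (c ∷ cs) +ᴿ hookSum F c (d ∷ dt) cs ∎

  -- The term in which the links among d ∷ dt are reversed and those from d through ls are kept. It
  -- is defined by the recursion itself: link dropped minus link reversed, a dropped link being a
  -- harmonic product absorbed into F.
  harmonicHook : (Index → Carrier) → Index → ℕ → ℕ → Index → Index → Carrier
  harmonicHook F v k d dt [] = F (v ++ (k + d) ∷ dt)
  harmonicHook F v k d dt (c ∷ cs) =
    harmonicHook (λ u → ∑ F (Stuffle _+_ u (d ∷ dt))) v k c [] cs -ᴿ
    harmonicHook F v k c (d ∷ dt) cs

  -- Induction on the kept links: by `hookSum-split`, the nested sums obey the recursion that
  -- defines `harmonicHook`.
  harmonicHook-hookSum : (F : Index → Carrier) → ∀ v k d dt ls →
    harmonicHook F v k d dt ls ≈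
    hookSum (λ w → ∑ (paired F) ((map plain v ∷ʳ (k , 1)) ✶ᴹ w)) d dt ls
  harmonicHook-hookSum F v k d dt [] = ≈.sym (paired-marks F v k d dt)
  harmonicHook-hookSum F v k d dt (c ∷ cs) = ≈.trans
    (+-congˡ (-‿cong (harmonicHook-hookSum F v k c (d ∷ dt) cs)))
    (≈.sym (+≈⇒≈- (begin
      harmonicHook (λ u → ∑ F (Stuffle _+_ u (d ∷ dt))) v k c [] cs
        ≈⟨ harmonicHook-hookSum _ v k c [] cs ⟩
      hookSum (λ w → ∑ (paired (λ u → ∑ F (Stuffle _+_ u (d ∷ dt)))) (k* ✶ᴹ w)) c [] cs
        ≈⟨ starSum-hookSum-[] _ c cs ⟨
      starSum (λ x xs → ∑ (paired (λ u → ∑ F (Stuffle _+_ u (d ∷ dt)))) (k* ✶ᴹ (x ∷ xs))) c cs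
        -- `paired-✶` turns the factor d ∷ dt hidden in F into a plain factor of the marked product;
        -- associativity then moves it onto the star chain.
        ≈⟨ starSum-cong (λ x xs → ≈.trans
             (∑-cong (λ y → ≈.sym (paired-✶ F y (d ∷ dt))) (k* ✶ᴹ (x ∷ xs)))
             (∑-Stuffle-assoc _⊕_ ⊕-assoc (paired F) k* (x ∷ xs) (map plain (d ∷ dt)))) c cs ⟩
      starSum (λ x xs → ∑ (λ y → ∑ (paired F) (k* ✶ᴹ y)) ((x ∷ xs) ✶ᴹ map plain (d ∷ dt))) c cs
        ≈⟨ hookSum-split _ d dt c cs ⟩
      hookSum (λ w → ∑ (paired F) (k* ✶ᴹ w)) d dt (c ∷ cs) +ᴿ
      hookSum (λ w → ∑ (paired F) (k* ✶ᴹ w)) c (d ∷ dt) cs ∎)))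
    where k* = map plain v ∷ʳ (k , 1)

  -- Justifies the marks: `_⊛_` is the part of the marked product in which the two last letters
  -- merge.
  ∑-⊛ : (F : Index → Carrier) → ∀ v k x xs →
    ∑ F ((v ∷ʳ k) ⊛ (x ∷ xs)) ≈ ∑ (paired F) ((map plain v ∷ʳ (k , 1)) ✶ᴹ markLast x xs)
  ∑-⊛ F v k x xs with snocView x xs
  ... | w , p , e rewrite markLast-∷ʳ w p x xs e | ≡.sym e | unsnoc-∷ʳ v k | unsnoc-∷ʳ w p = begin
    ∑ F ((map (_∷ʳ (k + p)) (v ✶ w) ++ []) ++ [])
      ≡⟨ ≡.cong (∑ F) (≡.trans (++-identityʳ _) (++-identityʳ _)) ⟩
    ∑ F (map (_∷ʳ (k + p)) (v ✶ w)) ≡⟨ ∑-map F _ (v ✶ w) ⟩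
    ∑ (λ x → F (x ∷ʳ (k + p))) (v ✶ w) ≡⟨ ≡.cong (∑ _) (Stuffle-ℕ v w) ⟨
    ∑ (λ x → F (x ∷ʳ (k + p))) (Stuffle _+_ v w) ≈⟨ paired-last-marks F v k w p ⟨
    ∑ (paired F) ((map plain v ∷ʳ (k , 1)) ✶ᴹ (map plain w ∷ʳ (p , 1))) ∎

  ∑-circStar : (F : Index → Carrier) → ∀ v k l ls →
    ∑ F (circStar (v ∷ʳ k) (l ∷ ls)) ≈ harmonicHook F v k l [] ls
  ∑-circStar F v k l ls = begin
    ∑ F (circStar (v ∷ʳ k) (l ∷ ls)) ≈⟨ ∑-concatMap F _ (starFrom l ls) ⟩
    ∑ (λ u → ∑ F ((v ∷ʳ k) ⊛ u)) (starFrom l ls)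
      ≈⟨ ∑-starFrom _ (λ w → ∑ (paired F) ((map plain v ∷ʳ (k , 1)) ✶ᴹ w)) (∑-⊛ F v k) l ls ⟩
    _ ≈⟨ starSum-hookSum-[] _ l ls ⟩
    _ ≈⟨ harmonicHook-hookSum F v k l [] ls ⟨
    harmonicHook F v k l [] ls ∎

-- Shuffles and permutations

-- Polymorphic, because linear extensions are shuffled as lists of poset elements before labels turn
-- them into words.
Shuffle : {A : Set} → List A → List A → List (List A)
Shuffle [] v = v ∷ []
Shuffle (a ∷ u) [] = (a ∷ u) ∷ []
Shuffle (a ∷ u) (b ∷ v) = map (a ∷_) (Shuffle u (b ∷ v)) ++ map (b ∷_) (Shuffle (a ∷ u) v)

map-Shuffle : {A : Set} (δ : A → Letter) → ∀ u v →
  map (map δ) (Shuffle u v) ≡ map δ u ⧢ map δ v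
map-Shuffle δ [] v = refl
map-Shuffle δ (a ∷ u) [] = refl
map-Shuffle δ (a ∷ u) (b ∷ v) = ≡.trans (map-++ (map δ) (map (a ∷_) xs) (map (b ∷_) ys))
  (≡.cong₂ _++_
    (≡.trans (≡.trans (≡.sym (map-∘ xs)) (map-∘ xs)) (≡.cong (map (δ a ∷_)) (map-Shuffle δ u (b ∷ v))))
    (≡.trans (≡.trans (≡.sym (map-∘ ys)) (map-∘ ys)) (≡.cong (map (δ b ∷_)) (map-Shuffle δ (a ∷ u) v))))
  where
  xs = Shuffle u (b ∷ v)
  ys = Shuffle (a ∷ u) v

Shuffle-[] : {A : Set} (u : List A) → Shuffle u [] ≡ u ∷ []
Shuffle-[] [] = refl
Shuffle-[] (a ∷ u) = refl

insertions-Shuffle : {A : Set} (x : A) → ∀ v → insertions x v ≡ Shuffle (x ∷ []) v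
insertions-Shuffle x [] = refl
insertions-Shuffle x (b ∷ v) = ≡.cong (λ xs → (x ∷ b ∷ v) ∷ map (b ∷_) xs) (insertions-Shuffle x v)

Interleaving-[]ˡ : {A : Set} (v : List A) → Interleaving [] v v
Interleaving-[]ˡ [] = []
Interleaving-[]ˡ (b ∷ v) = consʳ (Interleaving-[]ˡ v)

Shuffle-Interleaving : {A : Set} → ∀ (u v : List A) → All (Interleaving u v) (Shuffle u v)
Shuffle-Interleaving [] v = Interleaving-[]ˡ v ∷ []
Shuffle-Interleaving (a ∷ u) [] = I.swap (Interleaving-[]ˡ (a ∷ u)) ∷ []
Shuffle-Interleaving (a ∷ u) (b ∷ v) = Allₚ.++⁺
  (Allₚ.map⁺ (All.map consˡ (Shuffle-Interleaving u (b ∷ v))))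
  (Allₚ.map⁺ (All.map consʳ (Shuffle-Interleaving (a ∷ u) v)))

permutations-↭ : {A : Set} (xs : List A) → All (_↭ xs) (permutations xs)
permutations-↭ [] = ↭-refl ∷ []
permutations-↭ (x ∷ xs) = Allₚ.concat⁺ (Allₚ.map⁺ (All.map extend (permutations-↭ xs)))
  where
  extend : ∀ {ys} → ys ↭ xs → All (_↭ x ∷ xs) (insertions x ys)
  extend {ys} ys↭xs rewrite insertions-Shuffle x ys =
    All.map (λ i → ↭-trans (I.toPermutation i) (prep x ys↭xs)) (Shuffle-Interleaving (x ∷ []) ys)

Unique-++⁻ : {A : Set} (xs : List A) {ys : List A} → Unique (xs ++ ys) →
  Unique xs × Unique ys × Disjoint xs ys
Unique-++⁻ [] ys! = [] , ys! , λ ()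
Unique-++⁻ (x ∷ xs) (x∉ ∷ xsys!) with Unique-++⁻ xs xsys!
... | xs! , ys! , xs#ys = Allₚ.++⁻ˡ xs x∉ ∷ xs! , ys! , λ where
  (here refl , ∈ys) → All.lookup (Allₚ.++⁻ʳ xs x∉) ∈ys refl
  (there ∈xs , ∈ys) → xs#ys (∈xs , ∈ys)

-- Relative positions in a list

≟ᴱ-sound : ∀ x y → (x ≟ᴱ y) ≡ true → x ≡ y
≟ᴱ-sound (a , b) (c , d) e with a ≡ᵇ c in p | b ≡ᵇ d in q
... | true | true = ≡.cong₂ _,_ (ℕₚ.≡ᵇ⇒≡ a c (≡.subst T (≡.sym p) tt)) (ℕₚ.≡ᵇ⇒≡ b d (≡.subst T (≡.sym q) tt))

≡ᵇ-refl : ∀ n → (n ≡ᵇ n) ≡ true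
≡ᵇ-refl zero = refl
≡ᵇ-refl (suc n) = ≡ᵇ-refl n

≟ᴱ-refl : ∀ x → (x ≟ᴱ x) ≡ true
≟ᴱ-refl (a , b) rewrite ≡ᵇ-refl a | ≡ᵇ-refl b = refl

≢⇒≟ᴱ-false : ∀ {x y} → x ≢ y → (x ≟ᴱ y) ≡ false
≢⇒≟ᴱ-false {x} {y} x≢y with x ≟ᴱ y in e
... | true = ⊥-elim (x≢y (≟ᴱ-sound x y e))
... | false = refl

before : Elem → Elem → List Elem → Bool
before x y σ = pos x σ <ᵇ pos y σ

-- The letters taken from v differ from x and y; they shift positions without affecting which of the
-- two is found first.
before-Interleaving : ∀ {u v τ x y} → Interleaving u v τ → x ∉ v → y ∉ v →
  before x y τ ≡ before x y u
before-Interleaving [] x∉v y∉v = refl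
before-Interleaving {a ∷ u} {x = x} {y} (consˡ i) x∉v y∉v with x ≟ᴱ a | y ≟ᴱ a
... | true  | true  = refl
... | true  | false = refl
... | false | true  = refl
... | false | false = before-Interleaving i x∉v y∉v
before-Interleaving (consʳ i) x∉v y∉v
  rewrite ≢⇒≟ᴱ-false (x∉v ∘ here) | ≢⇒≟ᴱ-false (y∉v ∘ here) =
  before-Interleaving i (x∉v ∘ there) (y∉v ∘ there)

-- `pos` gives an absent element the length of the list, so two absent elements would tie;
-- membership of x excludes this.
before-exclusive : ∀ {x y σ} → x ∈ σ → x ≢ y → before y x σ ≡ not (before x y σ)
before-exclusive {x} {y} {z ∷ σ} x∈ x≢y with x ≟ᴱ z in p | y ≟ᴱ z in q
... | true  | true  = ⊥-elim (x≢y (≡.trans (≟ᴱ-sound x z p) (≡.sym (≟ᴱ-sound y z q))))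
... | true  | false = refl
... | false | true  = refl
before-exclusive {x} (here refl) x≢y | false | false with () ← ≡.trans (≡.sym p) (≟ᴱ-refl x)
before-exclusive (there x∈) x≢y | false | false = before-exclusive x∈ x≢y

respects-++ : ∀ g h σ → respects (g ++ h) σ ≡ respects g σ ∧ respects h σ
respects-++ [] h σ = refl
respects-++ ((x , y) ∷ g) h σ rewrite respects-++ g h σ =
  ≡.sym (∧-assoc (before x y σ) (respects g σ) (respects h σ))

Endpoints : (Elem → Set) → List (Elem × Elem) → Set
Endpoints P = All (λ g → P (proj₁ g) × P (proj₂ g))

respects-Interleaving : ∀ {u v τ g} → Interleaving u v τ → Endpoints (_∉ v) g →
  respects g τ ≡ respects g u
respects-Interleaving i [] = refl
respects-Interleaving i ((x∉v , y∉v) ∷ ps) =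
  ≡.cong₂ _∧_ (before-Interleaving i x∉v y∉v) (respects-Interleaving i ps)

chain-Endpoints : ∀ xs → Endpoints (_∈ xs) (chain xs)
chain-Endpoints [] = []
chain-Endpoints (x ∷ []) = []
chain-Endpoints (x ∷ y ∷ xs) =
  (here refl , there (here refl)) ∷
  All.map (λ (p , q) → there p , there q) (chain-Endpoints (y ∷ xs))

lastOf : {A : Set} → A → List A → A
lastOf x [] = x
lastOf x (y ∷ ys) = lastOf y ys

lastOf-∈ : {A : Set} (x : A) (xs : List A) → lastOf x xs ∈ x ∷ xs
lastOf-∈ x [] = here refl
lastOf-∈ x (y ∷ ys) = there (lastOf-∈ y ys)

lastOf-++ : {A : Set} → ∀ a as (c : A) ct → lastOf a (as ++ c ∷ ct) ≡ lastOf c ct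
lastOf-++ a [] c ct = refl
lastOf-++ a (b ∷ as) c ct = lastOf-++ b as c ct

respects-chain-++ : ∀ c ct d dt σ → respects (chain (c ∷ ct ++ d ∷ dt)) σ ≡
  before (lastOf c ct) d σ ∧ (respects (chain (c ∷ ct)) σ ∧ respects (chain (d ∷ dt)) σ)
respects-chain-++ c [] d dt σ = refl
respects-chain-++ c (c′ ∷ ct) d dt σ rewrite respects-chain-++ c′ ct d dt σ =
  exchange (before c c′ σ) (before (lastOf c′ ct) d σ) (respects (chain (c′ ∷ ct)) σ) (respects (chain (d ∷ dt)) σ)
  where
  exchange : ∀ p q r s → p ∧ (q ∧ (r ∧ s)) ≡ q ∧ ((p ∧ r) ∧ s)
  exchange true q r s = refl
  exchange false true r s = refl
  exchange false false r s = refl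

-- A zigzag poset consists of a chain A below the last column and of columns
-- d ∷ dt, cs; the head of each column lies below the last element of the next.

Column : Set
Column = Elem × List Elem

elements : List Elem → Elem → List Elem → List Column → List Elem
elements A d dt [] = A ++ d ∷ dt
elements A d dt ((c , ct) ∷ cs) = elements A c ct cs ++ d ∷ dt

relations : List Elem → Elem → List Elem → List Column → List (Elem × Elem)
relations A d dt [] = chain (A ++ d ∷ dt)
relations A d dt ((c , ct) ∷ cs) =
  (d , lastOf c ct) ∷ relations A c ct cs ++ chain (d ∷ dt)

elements-extend : ∀ A c ct cs ys → elements A c (ct ++ ys) cs ≡ elements A c ct cs ++ ys
elements-extend A c ct [] ys = ≡.sym (++-assoc A (c ∷ ct) ys)
elements-extend A c ct ((b , bt) ∷ cs) ys = ≡.sym (++-assoc (elements A b bt cs) (c ∷ ct) ys)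

respects-chain-extend : ∀ A c ct d dt σ → respects (chain (A ++ c ∷ ct ++ d ∷ dt)) σ ≡
  before (lastOf c ct) d σ ∧ (respects (chain (A ++ c ∷ ct)) σ ∧ respects (chain (d ∷ dt)) σ)
respects-chain-extend [] c ct d dt σ = respects-chain-++ c ct d dt σ
respects-chain-extend (a ∷ A) c ct d dt σ
  rewrite ≡.sym (++-assoc A (c ∷ ct) (d ∷ dt)) | ≡.sym (lastOf-++ a A c ct) =
  respects-chain-++ a (A ++ c ∷ ct) d dt σ

-- Reversing the link between the columns of d and c stacks d ∷ dt on top of c ∷ ct. The link to the
-- next column involves only the head c and is unaffected.
respects-extend : ∀ A c ct cs d dt σ → respects (relations A c (ct ++ d ∷ dt) cs) σ ≡
  before (lastOf c ct) d σ ∧ (respects (relations A c ct cs) σ ∧ respects (chain (d ∷ dt)) σ)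
respects-extend A c ct [] d dt σ = respects-chain-extend A c ct d dt σ
respects-extend A c ct ((b , bt) ∷ cs) d dt σ
  rewrite respects-++ (relations A b bt cs) (chain (c ∷ ct ++ d ∷ dt)) σ
        | respects-++ (relations A b bt cs) (chain (c ∷ ct)) σ
        | respects-chain-++ c ct d dt σ =
  exchange (before c (lastOf b bt) σ) (respects (relations A b bt cs) σ) (before (lastOf c ct) d σ)
    (respects (chain (c ∷ ct)) σ) (respects (chain (d ∷ dt)) σ)
  where
  exchange : ∀ p q r s t → p ∧ (q ∧ (r ∧ (s ∧ t))) ≡ r ∧ ((p ∧ (q ∧ s)) ∧ t)
  exchange true true r s t = refl
  exchange true false true s t = refl
  exchange true false false s t = refl
  exchange false q true s t = refl
  exchange false q false s t = refl

column-⊆ : ∀ A d dt cs {x} → x ∈ d ∷ dt → x ∈ elements A d dt cs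
column-⊆ A d dt [] = ∈-++⁺ʳ A
column-⊆ A d dt ((c , ct) ∷ cs) = ∈-++⁺ʳ (elements A c ct cs)

relations-Endpoints : ∀ A d dt cs → Endpoints (_∈ elements A d dt cs) (relations A d dt cs)
relations-Endpoints A d dt [] = chain-Endpoints (A ++ d ∷ dt)
relations-Endpoints A d dt ((c , ct) ∷ cs) =
  (∈-++⁺ʳ X (here refl) , ∈-++⁺ˡ (column-⊆ A c ct cs (lastOf-∈ c ct))) ∷
  Allₚ.++⁺
    (All.map (λ (p , q) → ∈-++⁺ˡ p , ∈-++⁺ˡ q) (relations-Endpoints A c ct cs))
    (All.map (λ (p , q) → ∈-++⁺ʳ X p , ∈-++⁺ʳ X q) (chain-Endpoints (d ∷ dt)))
  where X = elements A c ct cs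

-- Sums over linear extensions

module Shuffles {c ℓ} (R : CommutativeRing c ℓ) where
  open RingSums R

  module _ {A : Set} where

    ∑-Shuffle-∷ : (F : List A → Carrier) → ∀ a u b v → ∑ F (Shuffle (a ∷ u) (b ∷ v)) ≈
      ∑ (F ∘ (a ∷_)) (Shuffle u (b ∷ v)) +ᴿ ∑ (F ∘ (b ∷_)) (Shuffle (a ∷ u) v)
    ∑-Shuffle-∷ F a u b v = ≈.trans (∑-++ F _ _)
      (+-cong (≈.reflexive (∑-map F (a ∷_) (Shuffle u (b ∷ v))))
        (≈.reflexive (∑-map F (b ∷_) (Shuffle (a ∷ u) v))))

    ∑-insertions-∷ : (F : List A → Carrier) → ∀ x y ys → ∑ F (insertions x (y ∷ ys)) ≈
      F (x ∷ y ∷ ys) +ᴿ ∑ (F ∘ (y ∷_)) (insertions x ys)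
    ∑-insertions-∷ F x y ys =
      ≈.trans (∑-∷ F _ _) (+-congˡ (≈.reflexive (∑-map F (y ∷_) (insertions x ys))))

    ∑-Shuffle-[] : (F : List A → Carrier) → ∀ u → ∑ F (Shuffle u []) ≈ F u
    ∑-Shuffle-[] F u rewrite Shuffle-[] u = ∑-singleton F u

    -- Inserting x is shuffling with a one-letter list, so this is associativity of the shuffle in
    -- that case. Both sides are compared by their first letter, which is x, a or b.
    ∑-insertions-Shuffle-assoc : (F : List A → Carrier) → ∀ x u v →
      ∑ (λ σ → ∑ F (insertions x σ)) (Shuffle u v) ≈
      ∑ (λ u′ → ∑ F (Shuffle u′ v)) (insertions x u)
    ∑-insertions-Shuffle-assoc F x [] v = begin
      ∑ (λ σ → ∑ F (insertions x σ)) (v ∷ []) ≈⟨ ∑-singleton _ v ⟩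
      ∑ F (insertions x v) ≡⟨ ≡.cong (∑ F) (insertions-Shuffle x v) ⟩
      ∑ F (Shuffle (x ∷ []) v) ≈⟨ ∑-singleton (λ u′ → ∑ F (Shuffle u′ v)) (x ∷ []) ⟨
      ∑ (λ u′ → ∑ F (Shuffle u′ v)) ((x ∷ []) ∷ []) ∎
    ∑-insertions-Shuffle-assoc F x (a ∷ u) [] = ≈.trans (∑-singleton _ (a ∷ u))
      (∑-cong (λ u′ → ≈.sym (∑-Shuffle-[] F u′)) (insertions x (a ∷ u)))
    ∑-insertions-Shuffle-assoc F x (a ∷ u) (b ∷ v) = begin
      ∑ (λ σ → ∑ F (insertions x σ)) (Shuffle (a ∷ u) (b ∷ v)) ≈⟨ ∑-Shuffle-∷ _ a u b v ⟩
      _ ≈⟨ +-cong (∑-cong (λ σ → ∑-insertions-∷ F x a σ) (Shuffle u (b ∷ v)))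
             (∑-cong (λ σ → ∑-insertions-∷ F x b σ) (Shuffle (a ∷ u) v)) ⟩
      _ ≈⟨ +-cong (∑-+ _ _ (Shuffle u (b ∷ v))) (∑-+ _ _ (Shuffle (a ∷ u) v)) ⟩
      _ ≈⟨ +-cong
             (+-congˡ (∑-insertions-Shuffle-assoc (F ∘ (a ∷_)) x u (b ∷ v)))
             (+-congˡ (≈.trans (∑-insertions-Shuffle-assoc (F ∘ (b ∷_)) x (a ∷ u) v)
               (∑-insertions-∷ _ x a u))) ⟩
      (∑ (F ∘ (x ∷_) ∘ (a ∷_)) (Shuffle u (b ∷ v)) +ᴿ
        ∑ (λ u′ → ∑ (F ∘ (a ∷_)) (Shuffle u′ (b ∷ v))) (insertions x u)) +ᴿ
      (∑ (F ∘ (x ∷_) ∘ (b ∷_)) (Shuffle (a ∷ u) v) +ᴿ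
        (∑ (F ∘ (b ∷_)) (Shuffle (x ∷ a ∷ u) v) +ᴿ
         ∑ (λ u′ → ∑ (F ∘ (b ∷_)) (Shuffle (a ∷ u′) v)) (insertions x u)))
        ≈⟨ solve 5 (λ p q r s t → (p ⊞ q) ⊞ (r ⊞ (s ⊞ t)) ⊜ ((p ⊞ r) ⊞ s) ⊞ (q ⊞ t))
             ≈.refl _ _ _ _ _ ⟩
      _ ≈⟨ +-cong (+-congʳ (∑-Shuffle-∷ _ a u b v)) (∑-+ _ _ (insertions x u)) ⟨
      _ ≈⟨ +-cong (∑-Shuffle-∷ F x (a ∷ u) b v)
             (∑-cong (λ u′ → ∑-Shuffle-∷ F a u′ b v) (insertions x u)) ⟨
      _ ≈⟨ ∑-insertions-∷ _ x a u ⟨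
      ∑ (λ u′ → ∑ F (Shuffle u′ (b ∷ v))) (insertions x (a ∷ u)) ∎

    -- An ordering of xs ++ ys is an ordering of each part together with a way to shuffle them. The
    -- head of xs is carried through the shuffle by the preceding associativity.
    ∑-permutations-++ : (F : List A → Carrier) → ∀ xs ys → ∑ F (permutations (xs ++ ys)) ≈
      ∑ (λ u → ∑ (λ v → ∑ F (Shuffle u v)) (permutations ys)) (permutations xs)
    ∑-permutations-++ F [] ys = ≈.trans (∑-cong (λ v → ≈.sym (∑-singleton F v)) (permutations ys))
      (≈.sym (∑-singleton (λ u → ∑ (λ v → ∑ F (Shuffle u v)) (permutations ys)) []))
    ∑-permutations-++ F (x ∷ xs) ys = begin
      ∑ F (permutations (x ∷ xs ++ ys)) ≈⟨ ∑-concatMap F (insertions x) (permutations (xs ++ ys)) ⟩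
      _ ≈⟨ ∑-permutations-++ _ xs ys ⟩
      _ ≈⟨ ∑-cong (λ u → ≈.trans
             (∑-cong (λ v → ∑-insertions-Shuffle-assoc F x u v) (permutations ys))
             (∑-comm _ (permutations ys) (insertions x u))) (permutations xs) ⟩
      _ ≈⟨ ∑-concatMap _ (insertions x) (permutations xs) ⟨
      ∑ (λ u → ∑ (λ v → ∑ F (Shuffle u v)) (permutations ys)) (permutations (x ∷ xs)) ∎

    -- Either side shuffles v with x, y in both relative orders.
    ∑-insertions-comm : (F : List A → Carrier) → ∀ x y v →
      ∑ (λ σ → ∑ F (insertions x σ)) (insertions y v) ≈
      ∑ (λ σ → ∑ F (insertions y σ)) (insertions x v)
    ∑-insertions-comm F x y v = begin
      _ ≈⟨ two x y ⟩
      _ ≈⟨ +-comm _ _ ⟩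
      _ ≈⟨ two y x ⟨
      _ ∎
      where
      two : ∀ x y → ∑ (λ σ → ∑ F (insertions x σ)) (insertions y v) ≈
        ∑ F (Shuffle (x ∷ y ∷ []) v) +ᴿ ∑ F (Shuffle (y ∷ x ∷ []) v)
      two x y rewrite insertions-Shuffle y v = ≈.trans (∑-insertions-Shuffle-assoc F x (y ∷ []) v)
        (≈.trans (∑-∷ _ _ _) (+-congˡ (∑-singleton _ _)))

    -- Needed because `QElems` and `elements` list the rows in different orders.
    ∑-permutations-↭ : (F : List A → Carrier) → ∀ {xs ys} → xs ↭ ys →
      ∑ F (permutations xs) ≈ ∑ F (permutations ys)
    ∑-permutations-↭ F ↭.refl = ≈.refl
    ∑-permutations-↭ F {x ∷ xs} {.x ∷ ys} (prep x p) = begin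
      _ ≈⟨ ∑-concatMap F (insertions x) (permutations xs) ⟩
      _ ≈⟨ ∑-permutations-↭ _ p ⟩
      _ ≈⟨ ∑-concatMap F (insertions x) (permutations ys) ⟨
      _ ∎
    ∑-permutations-↭ F {x ∷ y ∷ xs} {.y ∷ .x ∷ ys} (swap x y p) = begin
      _ ≈⟨ unfold x y xs ⟩
      _ ≈⟨ ∑-permutations-↭ _ p ⟩
      _ ≈⟨ ∑-cong (λ v → ∑-insertions-comm F x y v) (permutations ys) ⟩
      _ ≈⟨ unfold y x ys ⟨
      _ ∎
      where
      unfold : ∀ x y xs → ∑ F (permutations (x ∷ y ∷ xs)) ≈
        ∑ (λ v → ∑ (λ σ → ∑ F (insertions x σ)) (insertions y v)) (permutations xs)
      unfold x y xs = ≈.trans (∑-concatMap F (insertions x) (permutations (y ∷ xs)))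
        (∑-concatMap _ (insertions y) (permutations xs))
    ∑-permutations-↭ F (↭.trans p q) = ≈.trans (∑-permutations-↭ F p) (∑-permutations-↭ F q)

  guard : Bool → Carrier → Carrier
  guard b x = if b then x else 0#

  guard-cong : ∀ b {x y} → x ≈ y → guard b x ≈ guard b y
  guard-cong true e = e
  guard-cong false e = ≈.refl

  guard-∧ : ∀ a b x → guard (a ∧ b) x ≡ guard a (guard b x)
  guard-∧ true b x = refl
  guard-∧ false b x = refl

  guard-split : ∀ a b x → guard (a ∧ b) x +ᴿ guard (not a ∧ b) x ≈ guard b x
  guard-split true b x = +-identityʳ _
  guard-split false b x = +-identityˡ _

  ∑-guard : {A : Set} (b : Bool) (f : A → Carrier) → ∀ xs → ∑ (λ x → guard b (f x)) xs ≈ guard b (∑ f xs)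
  ∑-guard true f xs = ≈.refl
  ∑-guard false f xs = ∑-0 xs

  ∑-filterᵇ : {A : Set} (f : A → Carrier) (p : A → Bool) → ∀ xs →
    ∑ f (filterᵇ p xs) ≈ ∑ (λ x → guard (p x) (f x)) xs
  ∑-filterᵇ f p [] = ≈.trans (∑-[] f) (≈.sym (∑-[] _))
  ∑-filterᵇ f p (x ∷ xs) with p x in e
  ... | true = begin
    ∑ f (x ∷ filterᵇ p xs) ≈⟨ ∑-∷ f x _ ⟩
    f x +ᴿ ∑ f (filterᵇ p xs)
      ≈⟨ +-cong (≈.reflexive (≡.cong (λ b → guard b (f x)) (≡.sym e))) (∑-filterᵇ f p xs) ⟩
    guard (p x) (f x) +ᴿ ∑ (λ y → guard (p y) (f y)) xs ≈⟨ ∑-∷ _ x xs ⟨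
    ∑ (λ y → guard (p y) (f y)) (x ∷ xs) ∎
  ... | false = begin
    ∑ f (filterᵇ p xs) ≈⟨ ∑-filterᵇ f p xs ⟩
    ∑ (λ y → guard (p y) (f y)) xs ≈⟨ +-identityˡ _ ⟨
    0# +ᴿ ∑ (λ y → guard (p y) (f y)) xs
      ≈⟨ +-congʳ (≈.reflexive (≡.cong (λ b → guard b (f x)) (≡.sym e))) ⟩
    guard (p x) (f x) +ᴿ ∑ (λ y → guard (p y) (f y)) xs ≈⟨ ∑-∷ _ x xs ⟨
    ∑ (λ y → guard (p y) (f y)) (x ∷ xs) ∎

  -- A guarded sum over all orderings instead of a filtered list, so that the guard can be split and
  -- factored pointwise.
  ∑ext : List (Elem × Elem) → (List Elem → Carrier) → List Elem → Carrier
  ∑ext g F X = ∑ (λ σ → guard (respects g σ) (F σ)) (permutations X)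

  -- Disjoint union of posets: a shuffle of u and v respects a relation with endpoints outside Y
  -- exactly when u does, and one with endpoints outside X exactly when v does.
  ∑ext-product : (F : List Elem → Carrier) → ∀ g h X Y →
    Endpoints (_∉ Y) g → Endpoints (_∉ X) h →
    ∑ext (g ++ h) F (X ++ Y) ≈ ∑ext g (λ u → ∑ext h (λ v → ∑ F (Shuffle u v)) Y) X
  ∑ext-product F g h X Y g∉Y h∉X = ≈.trans (∑-permutations-++ _ X Y)
    (∑-cong-All (All.map (λ {u} u↭X → ≈.trans
      (∑-cong-All (All.map (λ {v} v↭Y → ≈.trans
        (∑-cong-All (All.map (λ {τ} i → ≈.reflexive (≡.trans
          (≡.cong (λ b → guard b (F τ)) (≡.trans (respects-++ g h τ) (≡.cong₂ _∧_
            (respects-Interleaving i (All.map (λ (p , q) → (p ∘ ∈-resp-↭ v↭Y) , (q ∘ ∈-resp-↭ v↭Y)) g∉Y))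
            (respects-Interleaving (I.swap i) (All.map (λ (p , q) → (p ∘ ∈-resp-↭ u↭X) , (q ∘ ∈-resp-↭ u↭X)) h∉X)))))
          (guard-∧ (respects g u) (respects h v) (F τ)))) (Shuffle-Interleaving u v)))
        (≈.trans (∑-guard (respects g u) _ (Shuffle u v)) (guard-cong (respects g u) (∑-guard (respects h v) _ (Shuffle u v)))))
        (permutations-↭ Y)))
      (∑-guard (respects g u) _ (permutations Y)))
      (permutations-↭ X)))

  ∑ext-cong : {F G : List Elem → Carrier} → ∀ g X → (∀ u → F u ≈ G u) → ∑ext g F X ≈ ∑ext g G X
  ∑ext-cong g X e = ∑-cong (λ u → guard-cong (respects g u) (e u)) (permutations X)

  ∑ext-chain : (F : List Elem → Carrier) → ∀ {X} → Unique X → ∑ext (chain X) F X ≈ F X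
  ∑ext-chain F {[]} [] = ∑-singleton _ []
  ∑ext-chain F {x ∷ []} (_ ∷ []) = ∑-singleton _ (x ∷ [])
  ∑ext-chain F {x ∷ y ∷ ys} (x∉ ∷ ys!) = begin
    _ ≈⟨ ∑-concatMap _ (insertions x) (permutations (y ∷ ys)) ⟩
    _ ≈⟨ ∑-cong-All (All.map collect (permutations-↭ (y ∷ ys))) ⟩
    ∑ext (chain (y ∷ ys)) (λ σ → ∑ (λ τ → guard (before x y τ) (F τ)) (insertions x σ)) (y ∷ ys)
      -- By induction only the ordering y ∷ ys remains; of the insertions of x into it, only the one
      -- at the front puts x before y.
      ≈⟨ ∑ext-chain _ ys! ⟩
    ∑ (λ τ → guard (before x y τ) (F τ)) (insertions x (y ∷ ys)) ≈⟨ ∑-insertions-∷ _ x y ys ⟩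
    guard (before x y (x ∷ y ∷ ys)) (F (x ∷ y ∷ ys)) +ᴿ
    ∑ (λ τ → guard (before x y (y ∷ τ)) (F (y ∷ τ))) (insertions x ys)
      ≈⟨ +-cong first (≈.trans (∑-cong later (insertions x ys)) (∑-0 (insertions x ys))) ⟩
    F (x ∷ y ∷ ys) +ᴿ 0# ≈⟨ +-identityʳ _ ⟩
    F (x ∷ y ∷ ys) ∎
    where
    g = chain (y ∷ ys)
    collect : ∀ {σ} → σ ↭ y ∷ ys →
      ∑ (λ τ → guard (before x y τ ∧ respects g τ) (F τ)) (insertions x σ) ≈
      guard (respects g σ) (∑ (λ τ → guard (before x y τ) (F τ)) (insertions x σ))
    collect {σ} σ↭ rewrite insertions-Shuffle x σ = ≈.trans
      (∑-cong-All (All.map (λ {τ} i → ≈.reflexive (≡.trans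
        (≡.cong (λ b → guard b (F τ)) (≡.trans (∧-comm (before x y τ) (respects g τ))
          (≡.cong (_∧ before x y τ) (respects-Interleaving (I.swap i)
            (All.map (λ (p , q) → x≢ p , x≢ q) (chain-Endpoints (y ∷ ys)))))))
        (guard-∧ (respects g σ) (before x y τ) (F τ)))) (Shuffle-Interleaving (x ∷ []) σ)))
      (∑-guard (respects g σ) _ (Shuffle (x ∷ []) σ))
      where
      x≢ : ∀ {z} → z ∈ y ∷ ys → z ∉ x ∷ []
      x≢ z∈ (here refl) = All.lookup x∉ z∈ refl
    first : guard (before x y (x ∷ y ∷ ys)) (F (x ∷ y ∷ ys)) ≈ F (x ∷ y ∷ ys)
    first rewrite ≟ᴱ-refl x | ≢⇒≟ᴱ-false {y} {x} (λ e → All.lookup x∉ (here refl) (≡.sym e)) = ≈.refl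
    later : ∀ τ → guard (before x y (y ∷ τ)) (F (y ∷ τ)) ≈ 0#
    later τ rewrite ≟ᴱ-refl y = ≈.refl

  -- The word-level form of the recursion of `harmonicHook`: a dropped link is a shuffle with d, a
  -- reversed link glues d behind the next column.
  wordHook : (Word → Carrier) → Word → Word → List Word → Carrier
  wordHook F a d [] = F (a ++ d)
  wordHook F a d (c ∷ cs) = wordHook (λ w → ∑ F (w ⧢ d)) a c cs -ᴿ wordHook F a (c ++ d) cs

  -- In every ordering either d precedes the last element p of the next column or p precedes d. So
  -- the extensions without this link (a disjoint union) split into those with the link and those
  -- with its reverse (a zigzag with one column fewer).
  ∑ext-zigzag : (δ : Elem → Letter) (F : Word → Carrier) → ∀ A d dt cs →
    Unique (elements A d dt cs) →
    ∑ext (relations A d dt cs) (F ∘ map δ) (elements A d dt cs) ≈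
    wordHook F (map δ A) (map δ (d ∷ dt)) (map (λ (c , ct) → map δ (c ∷ ct)) cs)
  ∑ext-zigzag δ F A d dt [] X! =
    ≈.trans (∑ext-chain (F ∘ map δ) X!) (≈.reflexive (≡.cong F (map-++ δ A (d ∷ dt))))
  ∑ext-zigzag δ F A d dt ((c , ct) ∷ cs) XY! with Unique-++⁻ (elements A c ct cs) XY!
  ... | X! , Y! , X#Y = begin
    ∑ext (relations A d dt ((c , ct) ∷ cs)) (F ∘ map δ) (X ++ Y)
      ≈⟨ +≈⇒≈- linkSplit ⟩
    ∑ext (g ++ chain Y) (F ∘ map δ) (X ++ Y) -ᴿ ∑ext ((p , d) ∷ g ++ chain Y) (F ∘ map δ) (X ++ Y)
      ≈⟨ +-cong free (-‿cong reversed) ⟩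
    wordHook (λ w → ∑ F (w ⧢ map δ Y)) (map δ A) (map δ (c ∷ ct)) cs′ -ᴿ
    wordHook F (map δ A) (map δ (c ∷ ct) ++ map δ Y) cs′ ∎
    where
    X = elements A c ct cs
    Y = d ∷ dt
    g = relations A c ct cs
    p = lastOf c ct
    cs′ = map (λ (c , ct) → map δ (c ∷ ct)) cs

    d≢p : d ≢ p
    d≢p e = X#Y (column-⊆ A c ct cs (lastOf-∈ c ct) , here (≡.sym e))

    linkSplit : ∑ext (g ++ chain Y) (F ∘ map δ) (X ++ Y) ≈
      ∑ext ((d , p) ∷ g ++ chain Y) (F ∘ map δ) (X ++ Y) +ᴿ
      ∑ext ((p , d) ∷ g ++ chain Y) (F ∘ map δ) (X ++ Y)
    linkSplit = ≈.sym (≈.trans (≈.sym (∑-+ _ _ (permutations (X ++ Y))))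
      (∑-cong-All (All.map (λ {σ} σ↭ → ≈.trans
        (+-congˡ (≈.reflexive (≡.cong (λ b → guard (b ∧ respects (g ++ chain Y) σ) (F (map δ σ)))
          (before-exclusive (∈-resp-↭ (↭-sym σ↭) (∈-++⁺ʳ X (here refl))) d≢p))))
        (guard-split (before d p σ) (respects (g ++ chain Y) σ) (F (map δ σ))))
        (permutations-↭ (X ++ Y)))))

    free : ∑ext (g ++ chain Y) (F ∘ map δ) (X ++ Y) ≈
      wordHook (λ w → ∑ F (w ⧢ map δ Y)) (map δ A) (map δ (c ∷ ct)) cs′
    free = begin
      _ ≈⟨ ∑ext-product (F ∘ map δ) g (chain Y) X Y
             (All.map (λ (x∈ , y∈) → (λ x∈Y → X#Y (x∈ , x∈Y)) , (λ y∈Y → X#Y (y∈ , y∈Y)))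
               (relations-Endpoints A c ct cs))
             (All.map (λ (x∈ , y∈) → (λ x∈X → X#Y (x∈X , x∈)) , (λ y∈X → X#Y (y∈X , y∈)))
               (chain-Endpoints Y)) ⟩
      _ ≈⟨ ∑ext-cong g X (λ u → ≈.trans (∑ext-chain _ Y!)
             (≈.reflexive (≡.trans (≡.sym (∑-map F (map δ) (Shuffle u Y)))
               (≡.cong (∑ F) (map-Shuffle δ u Y))))) ⟩
      _ ≈⟨ ∑ext-zigzag δ (λ w → ∑ F (w ⧢ map δ Y)) A c ct cs X! ⟩
      _ ∎

    reversed : ∑ext ((p , d) ∷ g ++ chain Y) (F ∘ map δ) (X ++ Y) ≈
      wordHook F (map δ A) (map δ (c ∷ ct) ++ map δ Y) cs′
    reversed = begin
      _ ≈⟨ ∑-cong (λ σ → ≈.reflexive (≡.cong (λ b → guard b (F (map δ σ)))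
             (≡.trans (≡.cong (before p d σ ∧_) (respects-++ g (chain Y) σ))
               (≡.sym (respects-extend A c ct cs d dt σ))))) (permutations (X ++ Y)) ⟩
      ∑ext (relations A c (ct ++ Y) cs) (F ∘ map δ) (X ++ Y)
        ≡⟨ ≡.cong (∑ext (relations A c (ct ++ Y) cs) (F ∘ map δ)) (elements-extend A c ct cs Y) ⟨
      ∑ext (relations A c (ct ++ Y) cs) (F ∘ map δ) (elements A c (ct ++ Y) cs)
        ≈⟨ ∑ext-zigzag δ F A c (ct ++ Y) cs (≡.subst Unique (≡.sym (elements-extend A c ct cs Y)) XY!) ⟩
      wordHook F (map δ A) (map δ (c ∷ ct ++ Y)) cs′
        ≡⟨ ≡.cong (λ w → wordHook F (map δ A) w cs′) (map-++ δ (c ∷ ct) Y) ⟩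
      wordHook F (map δ A) (map δ (c ∷ ct) ++ map δ Y) cs′ ∎

-- Minimal elements are labelled e1 and maximal elements e0

chain-pred : ∀ z ys {x} → x ∈ ys → ∃ λ y → (y , x) ∈ chain (z ∷ ys)
chain-pred z (y ∷ ys) (here refl) = z , here refl
chain-pred z (y ∷ ys) (there x∈) = map₂ there (chain-pred y ys x∈)

chain-succ : ∀ xs d dt {x} → x ∈ xs → ∃ λ y → (x , y) ∈ chain (xs ++ d ∷ dt)
chain-succ (x ∷ []) d dt (here refl) = d , here refl
chain-succ (x ∷ y ∷ xs) d dt (here refl) = y , here refl
chain-succ (x ∷ y ∷ xs) d dt (there x∈) = map₂ there (chain-succ (y ∷ xs) d dt x∈)

-- The last column continues the chain A, so for non-empty A its head is not minimal and carries e0;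
-- the heads of the other columns are minimal and carry e1.
Labelled : (Elem → Letter) → Elem → List Elem → List Column → Set
Labelled δ d dt [] = All (λ x → δ x ≡ e0) (d ∷ dt)
Labelled δ d dt ((c , ct) ∷ cs) = δ d ≡ e1 × All (λ x → δ x ≡ e0) dt × Labelled δ c ct cs

module _ (δ : Elem → Letter) (a : Elem) (as : List Elem) where

  e1-or-pred : ∀ d dt cs → δ a ≡ e1 → Labelled δ d dt cs → ∀ {x} → x ∈ elements (a ∷ as) d dt cs →
    δ x ≡ e1 ⊎ ∃ λ y → (y , x) ∈ relations (a ∷ as) d dt cs
  e1-or-pred d dt [] δa δd (here refl) = inj₁ δa
  e1-or-pred d dt [] δa δd (there x∈) = inj₂ (chain-pred a (as ++ d ∷ dt) x∈)
  e1-or-pred d dt ((c , ct) ∷ cs) δa (δd , δdt , δcs) x∈ with ∈-++⁻ (elements (a ∷ as) c ct cs) x∈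
  ... | inj₁ x∈X = Sum.map₂ (map₂ (there ∘ ∈-++⁺ˡ)) (e1-or-pred c ct cs δa δcs x∈X)
  ... | inj₂ (here refl) = inj₁ δd
  ... | inj₂ (there x∈dt) =
    inj₂ (map₂ (there ∘ ∈-++⁺ʳ (relations (a ∷ as) c ct cs)) (chain-pred d dt x∈dt))

  e0-or-succ : ∀ d dt cs → Labelled δ d dt cs → ∀ {x} → x ∈ elements (a ∷ as) d dt cs →
    δ x ≡ e0 ⊎ ∃ λ y → (x , y) ∈ relations (a ∷ as) d dt cs
  e0-or-succ d dt [] δd x∈ with ∈-++⁻ (a ∷ as) x∈
  ... | inj₁ x∈A = inj₂ (chain-succ (a ∷ as) d dt x∈A)
  ... | inj₂ x∈d = inj₁ (All.lookup δd x∈d)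
  e0-or-succ d dt ((c , ct) ∷ cs) (δd , δdt , δcs) x∈ with ∈-++⁻ (elements (a ∷ as) c ct cs) x∈
  ... | inj₁ x∈X = Sum.map₂ (map₂ (there ∘ ∈-++⁺ˡ)) (e0-or-succ c ct cs δcs x∈X)
  ... | inj₂ (here refl) = inj₂ (lastOf c ct , here refl)
  ... | inj₂ (there x∈dt) = inj₁ (All.lookup δdt x∈dt)

respects-lookup : ∀ {g σ x y} → respects g σ ≡ true → (x , y) ∈ g → before x y σ ≡ true
respects-lookup {(x , y) ∷ g} {σ} e (here refl) with before x y σ
... | true = refl
respects-lookup {(x , y) ∷ g} {σ} e (there i) with before x y σ
... | true = respects-lookup {σ = σ} e i

before-head : ∀ x y σ → before y x (x ∷ σ) ≡ false
before-head x y σ rewrite ≟ᴱ-refl x = refl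

before-last : ∀ τ {z y} → z ∉ τ → y ∈ τ ∷ʳ z → before z y (τ ∷ʳ z) ≡ false
before-last [] {z} z∉ (here refl) rewrite ≟ᴱ-refl z = refl
before-last (t ∷ τ) {z} {y} z∉ y∈ rewrite ≢⇒≟ᴱ-false (z∉ ∘ here) with y ≟ᴱ t in e
... | true = refl
before-last (t ∷ τ) z∉ (here refl) | false with () ← ≡.trans (≡.sym e) (≟ᴱ-refl t)
before-last (t ∷ τ) z∉ (there y∈) | false = before-last τ (z∉ ∘ there) y∈

-- The n leading zeros belong to a letter whose e1 stands further left and whose entry becomes n +
-- 1. `LastGe2 (suc n ∷ ks)` is the condition on the last entry once that e1 has been read; the
-- final e0 gives the start n = 1.
decode : ∀ w → ∃₂ λ n ks → w ∷ʳ e0 ≡ replicate0 n ++ toWord ks × IsIndex ks × LastGe2 (suc n ∷ ks)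
decode [] = 1 , [] , refl , [] , s≤s (s≤s z≤n)
decode (e0 ∷ w) with decode w
... | n , [] , e , [] , last = suc n , [] , ≡.cong (e0 ∷_) e , [] , ℕₚ.m≤n⇒m≤1+n last
... | n , k ∷ ks , e , ks≥1 , last = suc n , k ∷ ks , ≡.cong (e0 ∷_) e , ks≥1 , last
decode (e1 ∷ w) with decode w
... | n , ks , e , ks≥1 , last = 0 , suc n ∷ ks , ≡.cong (e1 ∷_) e , s≤s z≤n ∷ ks≥1 , last

IsAdmissibleWord : Word → Set
IsAdmissibleWord w = ∃ λ u → Admissible u × w ≡ toWord u

isAdmissibleWord : ∀ v w → e1 ∷ v ≡ w ∷ʳ e0 → IsAdmissibleWord (e1 ∷ v)
isAdmissibleWord v (x ∷ w) e with ∷-injective e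
... | refl , refl with decode w
... | n , ks , e′ , ks≥1 , last = suc n ∷ ks , (s≤s z≤n ∷ ks≥1 , last) , ≡.cong (e1 ∷_) e′

-- The first element of a linear extension has no predecessor and the last one no successor, so the
-- word starts with e1 and ends with e0.
extension-admissible : ∀ δ a as d dt cs → Unique (elements (a ∷ as) d dt cs) →
  δ a ≡ e1 → Labelled δ d dt cs → ∀ {σ} → σ ↭ elements (a ∷ as) d dt cs →
  respects (relations (a ∷ as) d dt cs) σ ≡ true → IsAdmissibleWord (map δ σ)
extension-admissible δ a as d dt cs X! δa δcs {[]} σ↭ ok
  with () ← ∈-resp-↭ (↭-sym σ↭) (column-⊆ (a ∷ as) d dt cs (here refl))
extension-admissible δ a as d dt cs X! δa δcs {x ∷ σ} σ↭ ok with snocView x σ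
... | τ , z , τz≡xσ = ≡.subst (λ y → IsAdmissibleWord (y ∷ map δ σ)) (≡.sym δx≡e1)
    (isAdmissibleWord (map δ σ) (map δ τ) (≡.trans (≡.cong (_∷ map δ σ) (≡.sym δx≡e1))
      (≡.trans (≡.cong (map δ) (≡.sym τz≡xσ)) (≡.trans (map-++ δ τ (z ∷ [])) (≡.cong (map δ τ ∷ʳ_) δz≡e0)))))
  where
  τz! : Unique (τ ∷ʳ z)
  τz! = ≡.subst Unique (≡.sym τz≡xσ) (↭ₛ.Unique-resp-↭ (≡.setoid Elem) (↭⇒↭ₛ (↭-sym σ↭)) X!)
  z∉τ : z ∉ τ
  z∉τ z∈τ = proj₂ (proj₂ (Unique-++⁻ τ τz!)) (z∈τ , here refl)
  z∈σ : z ∈ x ∷ σ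
  z∈σ = ≡.subst (z ∈_) τz≡xσ (∈-++⁺ʳ τ (here refl))
  δx≡e1 : δ x ≡ e1
  δx≡e1 with e1-or-pred δ a as d dt cs δa δcs (∈-resp-↭ σ↭ (here refl))
  ... | inj₁ e = e
  ... | inj₂ (y , yx∈) with () ← ≡.trans (≡.sym (before-head x y σ)) (respects-lookup {σ = x ∷ σ} ok yx∈)
  δz≡e0 : δ z ≡ e0
  δz≡e0 with e0-or-succ δ a as d dt cs δcs (∈-resp-↭ σ↭ z∈σ)
  ... | inj₁ e = e
  ... | inj₂ (y , zy∈) with () ← ≡.trans
        (≡.sym (before-last τ z∉τ (≡.subst (y ∈_) (≡.sym τz≡xσ)
          (∈-resp-↭ (↭-sym σ↭) (proj₂ (All.lookup (relations-Endpoints (a ∷ as) d dt cs) zy∈))))))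
        (≡.trans (≡.cong (before z y) τz≡xσ) (respects-lookup {σ = x ∷ σ} ok zy∈))

-- The poset Q as a zigzag

range : ℕ → ℕ → List ℕ
range a zero = []
range a (suc n) = a ∷ range (suc a) n

oneTo-range : ∀ n → oneTo n ≡ range 1 n
oneTo-range n = shifted n 0 (λ i → i) (λ _ → refl)
  where
  shifted : ∀ n a f → (∀ i → f i ≡ a + i) → map suc (applyUpTo f n) ≡ range (suc a) n
  shifted zero a f e = refl
  shifted (suc n) a f e = ≡.cong₂ _∷_ (≡.cong suc (≡.trans (e 0) (ℕₚ.+-identityʳ a)))
    (shifted n (suc a) (f ∘ suc) (λ i → ≡.trans (e (suc i)) (ℕₚ.+-suc a i)))

range-bounds : ∀ a n → All (λ t → a ≤ t × t < a + n) (range a n)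
range-bounds a zero = []
range-bounds a (suc n) =
  (ℕₚ.≤-refl , ℕₚ.m<m+n a (s≤s z≤n)) ∷
  All.map (λ {t} (p , q) → ℕₚ.<⇒≤ p , ≡.subst (t <_) (≡.sym (ℕₚ.+-suc a n)) q) (range-bounds (suc a) n)

range-++ : ∀ a m n → range a (m + n) ≡ range a m ++ range (a + m) n
range-++ a zero n rewrite ℕₚ.+-identityʳ a = refl
range-++ a (suc m) n rewrite ℕₚ.+-suc a m = ≡.cong (a ∷_) (range-++ (suc a) m n)

range-Unique : ∀ a n → Unique (range a n)
range-Unique a zero = []
range-Unique a (suc n) =
  All.map (λ (a<t , _) a≡t → ℕₚ.<⇒≢ a<t a≡t) (range-bounds (suc a) n) ∷ range-Unique (suc a) n

lastOf-range : ∀ (j : ℕ) a n → lastOf (j , a) (map (j ,_) (range (suc a) n)) ≡ (j , a + n)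
lastOf-range j a zero = ≡.cong (j ,_) (≡.sym (ℕₚ.+-identityʳ a))
lastOf-range j a (suc n) = ≡.trans (lastOf-range j (suc a) n) (≡.cong (j ,_) (≡.sym (ℕₚ.+-suc a n)))

row : ℕ → ℕ → List Elem
row j l = map (j ,_) (oneTo l)

row-range : ∀ j l → row j l ≡ map (j ,_) (range 1 l)
row-range j l = ≡.cong (map (j ,_)) (oneTo-range l)

rowTail : ℕ → ℕ → List Elem
rowTail j l = map (j ,_) (range 2 (l ∸ 1))

row-∷ : ∀ j l → 1 ≤ l → row j l ≡ (j , 1) ∷ rowTail j l
row-∷ j (suc l) _ = row-range j (suc l)

columns : ℕ → Index → List Column
columns j [] = []
columns j (l ∷ ls) = ((j , 1) , rowTail j l) ∷ columns (suc j) ls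

rows : ℕ → Index → List Elem
rows j ls = concatMap (λ p → row (proj₁ p) (proj₂ p)) (enumFrom j ls)

rows-↭ : ∀ A j l ls → IsIndex (l ∷ ls) →
  A ++ rows j (l ∷ ls) ↭ elements A (j , 1) (rowTail j l) (columns (suc j) ls)
rows-↭ A j l [] (l≥1 ∷ _) =
  ↭-reflexive (≡.cong (A ++_) (≡.trans (++-identityʳ (row j l)) (row-∷ j l l≥1)))
rows-↭ A j l (l′ ∷ ls) (l≥1 ∷ ls≥1) rewrite row-∷ j l l≥1 =
  ↭-trans (++⁺ˡ A (++-comm ((j , 1) ∷ rowTail j l) (rows (suc j) (l′ ∷ ls))))
    (↭-trans (↭-reflexive (≡.sym (++-assoc A (rows (suc j) (l′ ∷ ls)) _)))
      (++⁺ʳ _ (rows-↭ A (suc j) l′ ls ls≥1)))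

rowChains : ℕ → Index → List (Elem × Elem)
rowChains j ls = concatMap (λ p → chain (row (proj₁ p) (proj₂ p))) (enumFrom j ls)

links : ℕ → Index → List (Elem × Elem)
links j ls = concatMap (λ p → if proj₁ p ≡ᵇ 1 then [] else ((proj₁ p ∸ 1 , 1) , (proj₁ p , proj₂ p)) ∷ [])
            (enumFrom j ls)

module ∧-Solver = Algebra.Solver.CommutativeMonoid ∧-commutativeMonoid

-- `QGens` groups the generators by kind, `relations` by column; induction on the columns matches
-- them up to reordering conjunctions. `suc j + length ls` numbers the last row, which continues the
-- chain a ∷ as.
respects-rows : ∀ a as j l ls → IsIndex (l ∷ ls) → ∀ σ →
  respects (chain (a ∷ as)) σ ∧ (before (lastOf a as) (suc j + length ls , 1) σ ∧
    (respects (rowChains (suc j) (l ∷ ls)) σ ∧ respects (links (suc (suc j)) ls) σ)) ≡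
  respects (relations (a ∷ as) (suc j , 1) (rowTail (suc j) l) (columns (suc (suc j)) ls)) σ
respects-rows a as j l [] (l≥1 ∷ _) σ
  rewrite row-∷ (suc j) l l≥1 | ++-identityʳ (chain ((suc j , 1) ∷ rowTail (suc j) l))
        | respects-chain-++ a as (suc j , 1) (rowTail (suc j) l) σ | ℕₚ.+-identityʳ j =
  solve 3 (λ p q r → p ⊕ᴮ (q ⊕ᴮ (r ⊕ᴮ id)) ⊜ q ⊕ᴮ (p ⊕ᴮ r)) refl
    (respects (chain (a ∷ as)) σ) (before (lastOf a as) (suc j , 1) σ)
    (respects (chain ((suc j , 1) ∷ rowTail (suc j) l)) σ)
  where open ∧-Solver renaming (_⊕_ to _⊕ᴮ_)
respects-rows a as j l (zero ∷ ls) (_ ∷ () ∷ _) σ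
respects-rows a as j l (suc l′ ∷ ls) (l≥1 ∷ ls≥1) σ
  rewrite row-∷ (suc j) l l≥1
        | respects-++ (chain ((suc j , 1) ∷ rowTail (suc j) l)) (rowChains (suc (suc j)) (suc l′ ∷ ls)) σ
        | respects-++ (relations (a ∷ as) (suc (suc j) , 1) (rowTail (suc (suc j)) (suc l′)) (columns (suc (suc (suc j))) ls))
            (chain ((suc j , 1) ∷ rowTail (suc j) l)) σ
        | ≡.sym (respects-rows a as (suc j) (suc l′) ls ls≥1 σ)
        | ℕₚ.+-suc j (length ls)
        | lastOf-range (suc (suc j)) 1 l′ =
  solve 6 (λ p q r s t u → p ⊕ᴮ (q ⊕ᴮ ((r ⊕ᴮ s) ⊕ᴮ (t ⊕ᴮ u))) ⊜ t ⊕ᴮ ((p ⊕ᴮ (q ⊕ᴮ (s ⊕ᴮ u))) ⊕ᴮ r)) refl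
    (respects (chain (a ∷ as)) σ) (before (lastOf a as) (suc (suc (j + length ls)) , 1) σ)
    (respects (chain ((suc j , 1) ∷ rowTail (suc j) l)) σ)
    (respects (rowChains (suc (suc j)) (suc l′ ∷ ls)) σ)
    (before (suc j , 1) (suc (suc j) , suc l′) σ)
    (respects (links (suc (suc (suc j))) ls) σ)
  where open ∧-Solver renaming (_⊕_ to _⊕ᴮ_)

row-Unique : ∀ j l → Unique (row j l)
row-Unique j l rewrite row-range j l =
  Uniqueₚ.map⁺ (λ { refl → refl }) (range-Unique 1 l)

row-fst : ∀ j (xs : List ℕ) → All (λ (x : Elem) → proj₁ x ≡ j) (map (j ,_) xs)
row-fst j [] = []
row-fst j (x ∷ xs) = refl ∷ row-fst j xs

Outside : ℕ → Elem → Set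
Outside j x = proj₁ x ≡ 0 ⊎ j < proj₁ x

disjoint-row : ∀ {X} j xs → 1 ≤ j → All (Outside j) X → Disjoint X (map (j ,_) xs)
disjoint-row j xs j≥1 X# {x} (∈X , ∈xs) with All.lookup X# ∈X
... | inj₁ x≡0 = ℕₚ.<⇒≢ j≥1 (≡.trans (≡.sym x≡0) (All.lookup (row-fst j xs) ∈xs))
... | inj₂ j<x = ℕₚ.<-irrefl (≡.sym (All.lookup (row-fst j xs) ∈xs)) j<x

elements-Outside : ∀ K j l ls →
  All (Outside j) (elements (row 0 K) (suc j , 1) (rowTail (suc j) l) (columns (suc (suc j)) ls))
elements-Outside K j l ls = cases ls
  where
  column-Outside : All (Outside j) ((suc j , 1) ∷ rowTail (suc j) l)
  column-Outside = All.map (λ e → inj₂ (≡.subst (j <_) (≡.sym e) ℕₚ.≤-refl)) (row-fst (suc j) (1 ∷ range 2 (l ∸ 1)))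
  cases : ∀ ls → All (Outside j) (elements (row 0 K) (suc j , 1) (rowTail (suc j) l) (columns (suc (suc j)) ls))
  cases [] = Allₚ.++⁺ (All.map inj₁ (row-fst 0 (oneTo K))) column-Outside
  cases (l′ ∷ ls) = Allₚ.++⁺ (All.map (Sum.map₂ ℕₚ.<⇒≤) (elements-Outside K (suc j) l′ ls)) column-Outside

elements-Unique : ∀ K j l ls → IsIndex (l ∷ ls) →
  Unique (elements (row 0 K) (suc j , 1) (rowTail (suc j) l) (columns (suc (suc j)) ls))
elements-Unique K j l [] (l≥1 ∷ _) rewrite ≡.sym (row-∷ (suc j) l l≥1) =
  Uniqueₚ.++⁺ (row-Unique 0 K) (row-Unique (suc j) l)
    (disjoint-row (suc j) (oneTo l) (s≤s z≤n) (All.map inj₁ (row-fst 0 (oneTo K))))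
elements-Unique K j l (l′ ∷ ls) (l≥1 ∷ ls≥1) rewrite ≡.sym (row-∷ (suc j) l l≥1) =
  Uniqueₚ.++⁺ (elements-Unique K (suc j) l′ ls ls≥1) (row-Unique (suc j) l)
    (disjoint-row (suc j) (oneTo l) (s≤s z≤n) (elements-Outside K (suc j) l′ ls))

-- The labels of Q

<⇒≡ᵇ-false : ∀ {m n} → m < n → (m ≡ᵇ n) ≡ false
<⇒≡ᵇ-false {zero} (s≤s _) = refl
<⇒≡ᵇ-false {suc m} (s≤s m<n) = <⇒≡ᵇ-false m<n

>⇒≡ᵇ-false : ∀ {m n} → n < m → (m ≡ᵇ n) ≡ false
>⇒≡ᵇ-false {suc m} {zero} (s≤s _) = refl
>⇒≡ᵇ-false {suc m} {suc n} (s≤s n<m) = >⇒≡ᵇ-false n<m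

-- The labels of the a_t with positions counted from an offset, as the induction on ks requires;
-- offset 0 gives `QLabel` on row 0.
chainLabel : Index → ℕ → ℕ → Letter
chainLabel ks acc t = if any (_≡ᵇ t) (headPositions ks acc) then e1 else e0

headPositions-> : ∀ ks acc → All (acc <_) (headPositions ks acc)
headPositions-> [] acc = []
headPositions-> (k ∷ ks) acc =
  ℕₚ.≤-refl ∷ All.map (ℕₚ.≤-<-trans (ℕₚ.m≤m+n acc k)) (headPositions-> ks (acc + k))

any-≡ᵇ-false : ∀ {t hs} → All (t <_) hs → any (_≡ᵇ t) hs ≡ false
any-≡ᵇ-false [] = refl
any-≡ᵇ-false (t<h ∷ hs) rewrite >⇒≡ᵇ-false t<h = any-≡ᵇ-false hs

map-cong-All : {A B : Set} {f g : A → B} {xs : List A} → All (λ x → f x ≡ g x) xs → map f xs ≡ map g xs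
map-cong-All [] = refl
map-cong-All (e ∷ es) = ≡.cong₂ _∷_ e (map-cong-All es)

map-e0-range : ∀ a n → map (λ _ → e0) (range a n) ≡ replicate0 n
map-e0-range a zero = refl
map-e0-range a (suc n) = ≡.cong (e0 ∷_) (map-e0-range (suc a) n)

-- Position suc acc is the head of the first block, the next k positions lie strictly before the
-- next head, and all later ones lie past the first head, which can then be dropped from the test.
chainLabel-word : ∀ ks acc → IsIndex ks →
  map (chainLabel ks acc) (range (suc acc) (weight ks)) ≡ toWord ks
chainLabel-word [] acc [] = refl
chainLabel-word (suc k ∷ ks) acc (_ ∷ ks≥1)
  rewrite ≡ᵇ-refl acc | range-++ (suc (suc acc)) k (weight ks)
        | map-++ (chainLabel (suc k ∷ ks) acc) (range (suc (suc acc)) k) (range (suc (suc (acc + k))) (weight ks))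
  = ≡.cong (e1 ∷_) (≡.cong₂ _++_ zeros rest)
  where
  zeros : map (chainLabel (suc k ∷ ks) acc) (range (suc (suc acc)) k) ≡ replicate0 k
  zeros = ≡.trans (map-cong-All (All.map zero-at (range-bounds (suc (suc acc)) k))) (map-e0-range _ k)
    where
    zero-at : ∀ {t} → suc acc < t × t < suc (suc acc) + k → chainLabel (suc k ∷ ks) acc t ≡ e0
    zero-at {t} (acc<t , t<) rewrite <⇒≡ᵇ-false acc<t
      | any-≡ᵇ-false {t} (All.map (ℕₚ.≤-<-trans (≡.subst (t ≤_) (≡.sym (ℕₚ.+-suc acc k)) (ℕₚ.≤-pred t<)))
          (headPositions-> ks (acc + suc k))) = refl
  rest : map (chainLabel (suc k ∷ ks) acc) (range (suc (suc (acc + k))) (weight ks)) ≡ toWord ks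
  rest = ≡.trans (map-cong-All (All.map same-at (range-bounds (suc (suc (acc + k))) (weight ks))))
    (≡.trans (≡.cong (λ a → map (chainLabel ks (acc + suc k)) (range (suc a) (weight ks))) (≡.sym (ℕₚ.+-suc acc k)))
      (chainLabel-word ks (acc + suc k) ks≥1))
    where
    same-at : ∀ {t} → suc (suc (acc + k)) ≤ t × t < suc (suc (acc + k)) + weight ks →
      chainLabel (suc k ∷ ks) acc t ≡ chainLabel ks (acc + suc k) t
    same-at {t} (≤t , _) rewrite <⇒≡ᵇ-false (ℕₚ.≤-trans (s≤s (s≤s (ℕₚ.m≤m+n acc k))) ≤t) = refl

row-word : ∀ ks ls → IsIndex ks → map (QLabel ks ls) (row 0 (weight ks)) ≡ toWord ks
row-word ks ls ks≥1 rewrite row-range 0 (weight ks) =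
  ≡.trans (≡.sym (map-∘ (range 1 (weight ks)))) (chainLabel-word ks 0 ks≥1)

rowTail-zeros : ∀ ks ls j a n → All (λ x → QLabel ks ls x ≡ e0) (map (suc j ,_) (range (suc (suc a)) n))
rowTail-zeros ks ls j a zero = []
rowTail-zeros ks ls j a (suc n) = refl ∷ rowTail-zeros ks ls j (suc a) n

rowTail-word : ∀ ks ls j a n → map (QLabel ks ls) (map (suc j ,_) (range (suc (suc a)) n)) ≡ replicate0 n
rowTail-word ks ls j a zero = refl
rowTail-word ks ls j a (suc n) = ≡.cong (e0 ∷_) (rowTail-word ks ls j (suc a) n)

lastColumn-label : ∀ ks ls j → j + 0 ≡ length ls → 1 ≤ j → QLabel ks ls (j , 1) ≡ e0
lastColumn-label ks ls (suc j) e _ rewrite ≡.sym e | ℕₚ.+-identityʳ j | ≡ᵇ-refl j = refl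

innerColumn-label : ∀ ks ls j n → j + suc n ≡ length ls → 1 ≤ j → QLabel ks ls (j , 1) ≡ e1
innerColumn-label ks ls (suc j) n e _ rewrite ≡.sym e | <⇒≡ᵇ-false (ℕₚ.m<m+n j {suc n} (s≤s z≤n)) = refl

columns-Labelled : ∀ ks ls₀ j l ls → suc j + length ls ≡ length ls₀ →
  Labelled (QLabel ks ls₀) (suc j , 1) (rowTail (suc j) l) (columns (suc (suc j)) ls)
columns-Labelled ks ls₀ j l [] e =
  lastColumn-label ks ls₀ (suc j) e (s≤s z≤n) ∷ rowTail-zeros ks ls₀ j 0 (l ∸ 1)
columns-Labelled ks ls₀ j l (l′ ∷ ls) e =
  innerColumn-label ks ls₀ (suc j) (length ls) e (s≤s z≤n) ,
  rowTail-zeros ks ls₀ j 0 (l ∸ 1) ,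
  columns-Labelled ks ls₀ (suc j) l′ ls (≡.trans (≡.sym (ℕₚ.+-suc (suc j) (length ls))) e)

respects-QGens : ∀ ks l ls → IsIndex (l ∷ ls) → 1 ≤ weight ks → ∀ σ →
  respects (QGens ks (l ∷ ls)) σ ≡
  respects (relations (row 0 (weight ks)) (1 , 1) (rowTail 1 l) (columns 2 ls)) σ
respects-QGens ks l ls ls≥1 K≥1 σ with weight ks
... | suc K rewrite row-∷ 0 (suc K) (s≤s z≤n)
  | respects-++ (chain ((0 , 1) ∷ rowTail 0 (suc K)))
      (((0 , suc K) , (suc (length ls) , 1)) ∷ rowChains 1 (l ∷ ls) ++ links 1 (l ∷ ls)) σ
  | respects-++ (rowChains 1 (l ∷ ls)) (links 1 (l ∷ ls)) σ
  | ≡.sym (lastOf-range 0 1 K) =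
  respects-rows (0 , 1) (rowTail 0 (suc K)) 0 l ls ls≥1 σ

QElems-↭ : ∀ ks l ls → IsIndex (l ∷ ls) →
  QElems ks (l ∷ ls) ↭ elements (row 0 (weight ks)) (1 , 1) (rowTail 1 l) (columns 2 ls)
QElems-↭ ks l ls = rows-↭ (row 0 (weight ks)) 1 l ls

weight-positive : ∀ ks → NonEmpty ks → IsIndex ks → 1 ≤ weight ks
weight-positive (k ∷ ks) _ (k≥1 ∷ _) = ℕₚ.≤-trans k≥1 (ℕₚ.m≤m+n k (weight ks))

NonEmpty-∷ʳ : ∀ v k → NonEmpty (v ∷ʳ k)
NonEmpty-∷ʳ [] k = tt
NonEmpty-∷ʳ (x ∷ v) k = tt

-- The integral side: evaluating μ(𝐤,𝐥)

module Posets {c ℓ} (R : CommutativeRing c ℓ) where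
  open RingSums R
  open Shuffles R

  -- The recursion of `harmonicHook` with the shuffle in place of the harmonic product. In the base
  -- case d is the last column, whose head is labelled e0: it contributes d zeros and so raises the
  -- last entry of 𝐤 by d.
  shuffleHook : (Word → Carrier) → Word → ℕ → Index → Index → Carrier
  shuffleHook F a d dt [] = F (a ++ replicate0 d ++ toWord dt)
  shuffleHook F a d dt (c ∷ cs) =
    shuffleHook (λ w → ∑ F (w ⧢ toWord (d ∷ dt))) a c [] cs -ᴿ shuffleHook F a c (d ∷ dt) cs

  -- Here dt lists the columns already stacked on the current one. None of them is the last column,
  -- so their heads carry e1 and they read as `toWord dt`.
  wordHook-columns : (F : Word → Carrier) → ∀ a ks ls₀ j d dt ls → IsIndex (d ∷ ls) →
    suc j + length ls ≡ length ls₀ →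
    wordHook F a (map (QLabel ks ls₀) ((suc j , 1) ∷ rowTail (suc j) d) ++ toWord dt)
      (map (λ (c , ct) → map (QLabel ks ls₀) (c ∷ ct)) (columns (suc (suc j)) ls)) ≈
    shuffleHook F a d dt ls
  wordHook-columns F a ks ls₀ j (suc d) dt [] _ e
    rewrite lastColumn-label ks ls₀ (suc j) e (s≤s z≤n) | rowTail-word ks ls₀ j 0 d = ≈.refl
  wordHook-columns F a ks ls₀ j d dt (c ∷ cs) (_ ∷ cs≥1) e
    rewrite innerColumn-label ks ls₀ (suc j) (length cs) e (s≤s z≤n) | rowTail-word ks ls₀ j 0 (d ∸ 1) =
    +-cong
      -- With the link dropped, the next column starts with nothing stacked on it.
      (≈.trans
        (≈.reflexive (≡.cong
          (λ w → wordHook (λ u → ∑ F (u ⧢ toWord (d ∷ dt))) a w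
            (map (λ (c , ct) → map (QLabel ks ls₀) (c ∷ ct)) (columns (suc (suc (suc j))) cs)))
          (≡.sym (++-identityʳ (map (QLabel ks ls₀) ((suc (suc j) , 1) ∷ rowTail (suc (suc j)) c))))))
        (wordHook-columns _ a ks ls₀ (suc j) c [] cs cs≥1 e′))
      (-‿cong (wordHook-columns F a ks ls₀ (suc j) c (d ∷ dt) cs cs≥1 e′))
    where e′ = ≡.trans (≡.sym (ℕₚ.+-suc (suc j) (length cs))) e

  module _ (ks : Index) (l : ℕ) (ls : Index)
    (ks≢[] : NonEmpty ks) (ks≥1 : IsIndex ks) (ls≥1 : IsIndex (l ∷ ls)) where

    private
      δ = QLabel ks (l ∷ ls)
      A = row 0 (weight ks)
      X = elements A (1 , 1) (rowTail 1 l) (columns 2 ls)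
      g = relations A (1 , 1) (rowTail 1 l) (columns 2 ls)

    ∑-μ-∑ext : (F : Word → Carrier) → ∑ F (μ ks (l ∷ ls)) ≈ ∑ext g (F ∘ map δ) X
    ∑-μ-∑ext F = begin
      _ ≡⟨ ∑-map F (map δ) _ ⟩
      _ ≈⟨ ∑-filterᵇ (F ∘ map δ) (respects (QGens ks (l ∷ ls))) (permutations (QElems ks (l ∷ ls))) ⟩
      _ ≈⟨ ∑-cong (λ σ → ≈.reflexive (≡.cong (λ b → guard b (F (map δ σ)))
             (respects-QGens ks l ls ls≥1 (weight-positive ks ks≢[] ks≥1) σ)))
             (permutations (QElems ks (l ∷ ls))) ⟩
      _ ≈⟨ ∑-permutations-↭ _ (QElems-↭ ks l ls ls≥1) ⟩
      ∑ext g (F ∘ map δ) X ∎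

    ∑-μ : (F : Word → Carrier) → ∑ F (μ ks (l ∷ ls)) ≈ shuffleHook F (toWord ks) l [] ls
    ∑-μ F = begin
      _ ≈⟨ ∑-μ-∑ext F ⟩
      _ ≈⟨ ∑ext-zigzag δ F A (1 , 1) (rowTail 1 l) (columns 2 ls) (elements-Unique (weight ks) 0 l ls ls≥1) ⟩
      _ ≡⟨ ≡.cong₂ (λ a w → wordHook F a w (map (λ (c , ct) → map δ (c ∷ ct)) (columns 2 ls)))
             (row-word ks (l ∷ ls) ks≥1) (≡.sym (++-identityʳ _)) ⟩
      _ ≈⟨ wordHook-columns F (toWord ks) ks (l ∷ ls) 0 l [] ls ls≥1 refl ⟩
      shuffleHook F (toWord ks) l [] ls ∎

    μ-admissible : ∀ {σ} → σ ↭ X → respects g σ ≡ true → IsAdmissibleWord (map δ σ)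
    μ-admissible σ↭ ok rewrite row-∷ 0 (weight ks) (weight-positive ks ks≢[] ks≥1) =
      extension-admissible δ (0 , 1) (rowTail 0 (weight ks)) (1 , 1) (rowTail 1 l) (columns 2 ls)
        (≡.subst (λ A → Unique (elements A (1 , 1) (rowTail 1 l) (columns 2 ls)))
          (row-∷ 0 (weight ks) (weight-positive ks ks≢[] ks≥1)) (elements-Unique (weight ks) 0 l ls ls≥1))
        (first ks ks≢[])
        (columns-Labelled ks (l ∷ ls) 0 l ls refl) σ↭ ok
      where
      first : ∀ ks → NonEmpty ks → QLabel ks (l ∷ ls) (0 , 1) ≡ e1
      first (k ∷ ks) _ = refl

    -- All words of μ(𝐤,𝐥) come from admissible indices, the only ones for which multiplicativity is
    -- assumed.
    ∑-μ-cong : (F G : Word → Carrier) → (∀ u → Admissible u → F (toWord u) ≈ G (toWord u)) →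
      ∑ F (μ ks (l ∷ ls)) ≈ ∑ G (μ ks (l ∷ ls))
    ∑-μ-cong F G e = ≈.trans (∑-μ-∑ext F)
      (≈.trans (∑-cong-All (All.map pointwise (permutations-↭ X))) (≈.sym (∑-μ-∑ext G)))
      where
      pointwise : ∀ {σ} → σ ↭ X → guard (respects g σ) (F (map δ σ)) ≈ guard (respects g σ) (G (map δ σ))
      pointwise {σ} σ↭ with respects g σ in ok
      ... | false = ≈.refl
      ... | true with μ-admissible σ↭ ok
      ...   | u , adm , w≡ rewrite w≡ = e u adm

-- Admissibility of the terms of 𝐤 ⊛ 𝐥^⋆, and merging of entries in words

LastGe2-∷ʳ : ∀ v {k} → 2 ≤ k → LastGe2 (v ∷ʳ k)
LastGe2-∷ʳ [] k≥2 = k≥2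
LastGe2-∷ʳ (x ∷ []) k≥2 = k≥2
LastGe2-∷ʳ (x ∷ y ∷ v) k≥2 = LastGe2-∷ʳ (y ∷ v) k≥2

LastGe2-∷ʳ⁻ : ∀ v {k} → LastGe2 (v ∷ʳ k) → 2 ≤ k
LastGe2-∷ʳ⁻ [] k≥2 = k≥2
LastGe2-∷ʳ⁻ (x ∷ []) k≥2 = k≥2
LastGe2-∷ʳ⁻ (x ∷ y ∷ v) k≥2 = LastGe2-∷ʳ⁻ (y ∷ v) k≥2

✶-IsIndex : ∀ {u v} → IsIndex u → IsIndex v → All IsIndex (u ✶ v)
✶-IsIndex {[]} [] v≥1 = v≥1 ∷ []
✶-IsIndex {a ∷ u} {[]} u≥1 [] = u≥1 ∷ []
✶-IsIndex {a ∷ u} {b ∷ v} (a≥1 ∷ u≥1) (b≥1 ∷ v≥1) = Allₚ.++⁺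
  (Allₚ.map⁺ (All.map (a≥1 ∷_) (✶-IsIndex u≥1 (b≥1 ∷ v≥1))))
  (Allₚ.++⁺ (Allₚ.map⁺ (All.map (b≥1 ∷_) (✶-IsIndex (a≥1 ∷ u≥1) v≥1)))
    (Allₚ.map⁺ (All.map (ℕₚ.≤-trans a≥1 (ℕₚ.m≤m+n a b) ∷_) (✶-IsIndex u≥1 v≥1))))

unsnoc-IsIndex : ∀ {u} → IsIndex u → All (λ (v , k) → IsIndex v × 1 ≤ k) (unsnoc u)
unsnoc-IsIndex [] = []
unsnoc-IsIndex (k≥1 ∷ []) = ([] , k≥1) ∷ []
unsnoc-IsIndex (k≥1 ∷ k′≥1 ∷ ks≥1) =
  Allₚ.map⁺ (All.map (λ (v≥1 , p≥1) → k≥1 ∷ v≥1 , p≥1) (unsnoc-IsIndex (k′≥1 ∷ ks≥1)))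

starFrom-IsIndex : ∀ {l ls} → 1 ≤ l → IsIndex ls → All IsIndex (starFrom l ls)
starFrom-IsIndex l≥1 [] = (l≥1 ∷ []) ∷ []
starFrom-IsIndex {l} {c ∷ _} l≥1 (c≥1 ∷ cs≥1) = Allₚ.++⁺
  (Allₚ.map⁺ (All.map (l≥1 ∷_) (starFrom-IsIndex c≥1 cs≥1)))
  (starFrom-IsIndex (ℕₚ.≤-trans l≥1 (ℕₚ.m≤m+n l c)) cs≥1)

-- The last entry of each term is a sum of two positive entries, hence at least 2.
circStar-Admissible : ∀ {ks ls} → IsIndex ks → IsIndex ls → All Admissible (circStar ks ls)
circStar-Admissible {ks} {[]} ks≥1 [] = []
circStar-Admissible {ks} {l ∷ ls} ks≥1 (l≥1 ∷ ls≥1) =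
  Allₚ.concat⁺ (Allₚ.map⁺ (All.map (λ u≥1 →
    Allₚ.concat⁺ (Allₚ.map⁺ (All.map (λ (v≥1 , k≥1) →
      Allₚ.concat⁺ (Allₚ.map⁺ (All.map (λ (w≥1 , p≥1) →
        Allₚ.map⁺ (All.map (λ {x} x≥1 →
          Allₚ.++⁺ x≥1 (ℕₚ.≤-trans k≥1 (ℕₚ.m≤m+n _ _) ∷ []) ,
          LastGe2-∷ʳ x (ℕₚ.+-mono-≤ k≥1 p≥1)) (✶-IsIndex v≥1 w≥1)))
        (unsnoc-IsIndex u≥1))))
      (unsnoc-IsIndex ks≥1))))
    (starFrom-IsIndex l≥1 ls≥1)))

replicate0-+ : ∀ m n → replicate0 (m + n) ≡ replicate0 m ++ replicate0 n
replicate0-+ zero n = refl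
replicate0-+ (suc m) n = ≡.cong (e0 ∷_) (replicate0-+ m n)

toWord-++ : ∀ u v → toWord (u ++ v) ≡ toWord u ++ toWord v
toWord-++ [] v = refl
toWord-++ (k ∷ u) v = ≡.trans (≡.cong (eWord k ++_) (toWord-++ u v)) (≡.sym (++-assoc (eWord k) (toWord u) (toWord v)))

-- Zeros written after e_k raise its entry. Positivity of k matters, since `eWord 0` and `eWord 1`
-- are the same word.
toWord-merge : ∀ v k d dt → 1 ≤ k →
  toWord (v ++ (k + d) ∷ dt) ≡ toWord (v ∷ʳ k) ++ replicate0 d ++ toWord dt
toWord-merge v (suc k) d dt _
  rewrite toWord-++ v ((suc k + d) ∷ dt) | toWord-++ v (suc k ∷ []) | replicate0-+ k d
        | ++-identityʳ (replicate0 k)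
        | ++-assoc (replicate0 k) (replicate0 d) (toWord dt) =
  ≡.sym (++-assoc (toWord v) (e1 ∷ replicate0 k) (replicate0 d ++ toWord dt))

-- Comparison of the two products under Z

module Products {c ℓ} (R : CommutativeRing c ℓ) where
  open RingSums R
  open Harmonic R
  open Posets R

  module _ (Z : Word → Carrier)
    (hyp : ∀ (k l : Index) → IsIndex k → NonEmpty k → IsIndex l → NonEmpty l →
      ∑ Z (μ k l) ≈ ∑ (Z ∘ toWord) (circStar k l)) where

    shuffled harmonic product : Index → Index → Carrier
    shuffled u v = ∑ Z (toWord u ⧢ toWord v)
    harmonic u v = ∑ (Z ∘ toWord) (u ✶ v)
    product u v = Z (toWord u) *ᴿ Z (toWord v)

    -- A common consequence of both multiplicativity hypotheses: the premise that the two products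
    -- agree lets the harmonic one be used for the shuffle. One induction thus serves both
    -- directions.
    module _ (multiplicative : ∀ u v → Admissible u → Admissible v →
      shuffled u v ≈ harmonic u v → shuffled u v ≈ product u v) where

      -- Induction on dt, mutual with the agreement of products. With no link reversed, the two
      -- hooks are the two sides of `hyp`; each further reversal uses the product with the shorter
      -- index.
      hooks-agree : ∀ d dt → Admissible (d ∷ dt) → ∀ v k ls → IsIndex (v ∷ʳ k) → IsIndex ls →
        shuffleHook Z (toWord (v ∷ʳ k)) d dt ls ≈ harmonicHook (Z ∘ toWord) v k d dt ls

      products-agree-∷ : ∀ d dt → Admissible (d ∷ dt) → ∀ u → Admissible u →
        shuffled u (d ∷ dt) ≈ harmonic u (d ∷ dt)

      -- Taken from the hooks with a single kept link to a last column (1). That column raises the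
      -- last entry of 𝐤 by one, so 𝐤 is chosen as v followed by k lowered by one, still positive
      -- because k ≥ 2.
      products-agree-∷ʳ : ∀ d dt → Admissible (d ∷ dt) → ∀ v k → IsIndex (v ∷ʳ k) → 2 ≤ k →
        shuffled (v ∷ʳ k) (d ∷ dt) ≈ harmonic (v ∷ʳ k) (d ∷ dt)

      hooks-agree d [] (d≥1 ∷ _ , _) v k ls vk≥1 ls≥1 = begin
        _ ≈⟨ ∑-μ (v ∷ʳ k) d ls (NonEmpty-∷ʳ v k) vk≥1 (d≥1 ∷ ls≥1) Z ⟨
        _ ≈⟨ hyp (v ∷ʳ k) (d ∷ ls) vk≥1 (NonEmpty-∷ʳ v k) (d≥1 ∷ ls≥1) tt ⟩
        _ ≈⟨ ∑-circStar (Z ∘ toWord) v k d ls ⟩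
        _ ∎
      hooks-agree d (d′ ∷ dt) (d≥1 ∷ dt≥1 , last) v k ls vk≥1 ls≥1 =
        -- Consider the link between d′ and d: its kept term agrees by induction, the product by the
        -- chain below, hence so does the reversed term.
        -ᴿ-cancelˡ (hooks-agree d′ dt (dt≥1 , last) v k (d ∷ ls) vk≥1 (d≥1 ∷ ls≥1)) (begin
          shuffleHook (λ w → ∑ Z (w ⧢ toWord ds)) (toWord (v ∷ʳ k)) d [] ls
            ≈⟨ ∑-μ (v ∷ʳ k) d ls (NonEmpty-∷ʳ v k) vk≥1 (d≥1 ∷ ls≥1) _ ⟨
          ∑ (λ w → ∑ Z (w ⧢ toWord ds)) (μ (v ∷ʳ k) (d ∷ ls))
            ≈⟨ ∑-μ-cong (v ∷ʳ k) d ls (NonEmpty-∷ʳ v k) vk≥1 (d≥1 ∷ ls≥1) _ _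
                 (λ u adm → multiplicative u ds adm (dt≥1 , last) (agree u adm)) ⟩
          ∑ (λ w → Z w *ᴿ Z (toWord ds)) (μ (v ∷ʳ k) (d ∷ ls)) ≈⟨ ∑-*ʳ Z _ _ ⟩
          ∑ Z (μ (v ∷ʳ k) (d ∷ ls)) *ᴿ Z (toWord ds)
            ≈⟨ *-congʳ (hyp (v ∷ʳ k) (d ∷ ls) vk≥1 (NonEmpty-∷ʳ v k) (d≥1 ∷ ls≥1) tt) ⟩
          ∑ (Z ∘ toWord) (circStar (v ∷ʳ k) (d ∷ ls)) *ᴿ Z (toWord ds) ≈⟨ ∑-*ʳ (Z ∘ toWord) _ _ ⟨
          ∑ (λ u → product u ds) (circStar (v ∷ʳ k) (d ∷ ls))
            -- On the series side the passage runs backwards, from the product of values to the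
            -- shuffle and from there to the harmonic product.
            ≈⟨ ∑-cong-All (All.map (λ {u} adm → ≈.trans
                 (≈.sym (multiplicative u ds adm (dt≥1 , last) (agree u adm)))
                 (≈.trans (agree u adm) (≈.reflexive (≡.cong (∑ (Z ∘ toWord)) (≡.sym (Stuffle-ℕ u ds))))))
                 (circStar-Admissible vk≥1 (d≥1 ∷ ls≥1))) ⟩
          ∑ (λ u → ∑ (Z ∘ toWord) (Stuffle _+_ u ds)) (circStar (v ∷ʳ k) (d ∷ ls))
            ≈⟨ ∑-circStar _ v k d ls ⟩
          harmonicHook (λ u → ∑ (Z ∘ toWord) (Stuffle _+_ u ds)) v k d [] ls ∎)
        where
        ds = d′ ∷ dt
        agree = products-agree-∷ d′ dt (dt≥1 , last)

      products-agree-∷ d dt adm [] _ = ≈.trans (∑-singleton Z _) (≈.sym (∑-singleton (Z ∘ toWord) (d ∷ dt)))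
      products-agree-∷ d dt adm (x ∷ xs) with snocView x xs
      ... | v , k , e = ≡.subst (λ u → Admissible u → shuffled u (d ∷ dt) ≈ harmonic u (d ∷ dt)) e
        (λ (vk≥1 , last) → products-agree-∷ʳ d dt adm v k vk≥1 (LastGe2-∷ʳ⁻ v last))

      products-agree-∷ʳ d dt adm v (suc zero) vk≥1 (s≤s ())
      products-agree-∷ʳ d dt adm v (suc (suc k)) vk≥1 _ = begin
        ∑ Z (toWord (v ∷ʳ suc (suc k)) ⧢ toWord ds)
          ≡⟨ ≡.cong (λ w → ∑ Z (w ⧢ toWord ds)) (merged []) ⟩
        ∑ Z ((toWord (v ∷ʳ suc k) ++ replicate0 1 ++ []) ⧢ toWord ds)
          ≈⟨ -ᴿ-cancel (hooks-agree d dt adm v (suc k) (1 ∷ []) v≥1 (s≤s z≤n ∷ []))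
               -- With the link reversed, both sides are Z of the same word.
               (≈.reflexive (≡.cong Z (≡.sym (toWord-merge v (suc k) 1 ds (s≤s z≤n))))) ⟩
        ∑ (Z ∘ toWord) (Stuffle _+_ (v ++ (suc k + 1) ∷ []) ds)
          ≡⟨ ≡.cong (∑ (Z ∘ toWord)) (Stuffle-ℕ (v ++ (suc k + 1) ∷ []) ds) ⟩
        harmonic (v ++ (suc k + 1) ∷ []) ds
          ≡⟨ ≡.cong (λ n → harmonic (v ∷ʳ n) ds) (ℕₚ.+-comm (suc k) 1) ⟩
        harmonic (v ∷ʳ suc (suc k)) ds ∎
        where
        ds = d ∷ dt
        merged : ∀ dt → toWord (v ++ suc (suc k) ∷ dt) ≡ toWord (v ∷ʳ suc k) ++ replicate0 1 ++ toWord dt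
        merged dt = ≡.trans (≡.cong (λ n → toWord (v ++ n ∷ dt)) (ℕₚ.+-comm 1 (suc k))) (toWord-merge v (suc k) 1 dt (s≤s z≤n))
        v≥1 : IsIndex (v ∷ʳ suc k)
        v≥1 = Allₚ.++⁺ (Allₚ.++⁻ˡ v vk≥1) (s≤s z≤n ∷ [])

      products-agree : ∀ u v → Admissible u → Admissible v → shuffled u v ≈ harmonic u v
      products-agree [] [] _ _ = ≈.trans (∑-singleton Z _) (≈.sym (∑-singleton (Z ∘ toWord) []))
      products-agree (x ∷ u) [] _ _ = ≈.trans (∑-singleton Z _) (≈.sym (∑-singleton (Z ∘ toWord) (x ∷ u)))
      products-agree u (d ∷ dt) u-adm v-adm = products-agree-∷ d dt v-adm u u-adm

theorem4p8 : {c ℓ : Level} (R : QAlgebra c ℓ) (Z : Word → QAlgebra.Carrier R) →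
    (∀ (k l : Index) → IsIndex k → NonEmpty k → IsIndex l → NonEmpty l →
    QAlgebra._≈_ R (Zsum R Z (μ k l)) (ZsumI R Z (circStar k l))) →
    ((∀ (k l : Index) → Admissible k → Admissible l →
    QAlgebra._≈_ R (Zsum R Z (toWord k ⧢ toWord l))
    (QAlgebra._*_ R (Z (toWord k)) (Z (toWord l))))
    ⇔
    (∀ (k l : Index) → Admissible k → Admissible l →
    QAlgebra._≈_ R (ZsumI R Z (k ✶ l))
    (QAlgebra._*_ R (Z (toWord k)) (Z (toWord l)))))
theorem4p8 R Z hyp = mk⇔
  -- Shuffle multiplicativity gives `multiplicative` outright; the agreement then transports it to
  -- the harmonic product.
  (λ S k l k-adm l-adm → ≈.trans (≈.reflexive (ZsumI-∑ (k ✶ l))) (≈.trans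
    (≈.sym (products-agree Z hyp′ (λ u v u-adm v-adm _ → shuffle-∑ S u v u-adm v-adm) k l k-adm l-adm))
    (shuffle-∑ S k l k-adm l-adm)))
  -- Harmonic multiplicativity gives `multiplicative` by composing with its premise e.
  (λ H k l k-adm l-adm → ≈.trans (≈.reflexive (Zsum-∑ (toWord k ⧢ toWord l))) (≈.trans
    (products-agree Z hyp′ (λ u v u-adm v-adm e → ≈.trans e (harmonic-∑ H u v u-adm v-adm)) k l k-adm l-adm)
    (harmonic-∑ H k l k-adm l-adm)))
  where
  open RingSums (QAlgebra.commRing R)
  open Products (QAlgebra.commRing R)
  Zsum-∑ : ∀ ws → Zsum R Z ws ≡ ∑ Z ws
  Zsum-∑ ws = ∑-foldr Z ws
  ZsumI-∑ : ∀ ks → ZsumI R Z ks ≡ ∑ (Z ∘ toWord) ks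
  ZsumI-∑ ks = ≡.trans (Zsum-∑ (map toWord ks)) (∑-map Z toWord ks)
  hyp′ : ∀ k l → IsIndex k → NonEmpty k → IsIndex l → NonEmpty l →
    ∑ Z (μ k l) ≈ ∑ (Z ∘ toWord) (circStar k l)
  hyp′ k l k≥1 k≢[] l≥1 l≢[] = ≈.trans (≈.reflexive (≡.sym (Zsum-∑ (μ k l))))
    (≈.trans (hyp k l k≥1 k≢[] l≥1 l≢[]) (≈.reflexive (ZsumI-∑ (circStar k l))))
  shuffle-∑ : (∀ k l → Admissible k → Admissible l →
      Zsum R Z (toWord k ⧢ toWord l) ≈ Z (toWord k) *ᴿ Z (toWord l)) →
    ∀ k l → Admissible k → Admissible l → ∑ Z (toWord k ⧢ toWord l) ≈ Z (toWord k) *ᴿ Z (toWord l)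
  shuffle-∑ S k l k-adm l-adm =
    ≈.trans (≈.reflexive (≡.sym (Zsum-∑ (toWord k ⧢ toWord l)))) (S k l k-adm l-adm)
  harmonic-∑ : (∀ k l → Admissible k → Admissible l →
      ZsumI R Z (k ✶ l) ≈ Z (toWord k) *ᴿ Z (toWord l)) →
    ∀ k l → Admissible k → Admissible l → ∑ (Z ∘ toWord) (k ✶ l) ≈ Z (toWord k) *ᴿ Z (toWord l)
  harmonic-∑ H k l k-adm l-adm =
    ≈.trans (≈.reflexive (≡.sym (ZsumI-∑ (k ✶ l)))) (H k l k-adm l-adm)
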